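{- Let $G$ be a connected graph, let $X\subseteq V(G)$, and let $F$ be a spanning forest of $G$. Let $\lambda\in[0,1]$ be a real number and let $\eta:X\rightarrow(\lambda,\infty)$ be a real function. If for all $S\subseteq X$, $$\omega(G\setminus S)\le\sum_{v\in S}\big(\eta(v)-2\big)+2-\lambda\big(e_G(S)+1\big),$$ then $G$ has a spanning tree $T$ containing $F$ such that for each $v\in X$, $d_T(v)\le\lceil\eta(v)-\lambda\rceil+\max\{0,d_F(v)-1\}$.
   Context: All graphs are finite, without loops, but multiple edges are allowed. $\omega(H)$ denotes the number of components of a graph $H$ (the null graph has $0$ components). $G\setminus S$ is the graph obtained from $G$ by deleting the vertices of $S$. $e_G(S)$ is the number of edges of $G$ with both ends in $S$. $d_H(v)$ is the degree of $v$ in $H$ (counting multiple edges). -}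

module Defs where

open import Level using (Level; _⊔_) renaming (suc to lsuc)
open import Data.Nat as ℕ using (ℕ; zero; suc)
open import Data.Integer as ℤ using (ℤ; +_; -[1+_])
open import Data.Fin using (Fin; zero; suc)
open import Data.Fin.Subset using (Subset; _∈_; _∩_; ∣_∣)
open import Data.Fin.Subset.Properties using (_∈?_)
open import Data.Vec using (tabulate)
import Data.Vec
open import Data.Bool using (Bool; _∧_; _∨_)
open import Data.Product using (Σ; _×_; _,_; proj₁; proj₂; ∃)
open import Data.Sum using (_⊎_)
open import Relation.Nullary using (¬_; Dec; yes; no)
open import Relation.Nullary.Decidable using (isYes)
open import Relation.Binary using (Rel; IsTotalOrder)
open import Relation.Binary.PropositionalEquality using (_≡_; _≢_)
open import Algebra.Bundles using (CommutativeRing)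
open import Data.Fin using (_≟_)

-- Real numbers, abstractly: an ordered field together with a ceiling
-- function into ℤ (hence Archimedean).  Every such field embeds into ℝ
-- preserving +, *, ≤ and ⌈_⌉, and ℝ is one of them, so quantifying over
-- all such structures is equivalent to the statement over ℝ.

record OrderedField (c ℓ₁ ℓ₂ : Level) : Set (lsuc (c ⊔ ℓ₁ ⊔ ℓ₂)) where
  field
    commutativeRing : CommutativeRing c ℓ₁
  open CommutativeRing commutativeRing public hiding (zero)
  field
    _≤_          : Rel Carrier ℓ₂
    isTotalOrder : IsTotalOrder _≈_ _≤_
    +-mono-≤     : ∀ {x y} z → x ≤ y → (x + z) ≤ (y + z)
    *-nonneg     : ∀ {x y} → 0# ≤ x → 0# ≤ y → 0# ≤ (x * y)
    1≉0          : ¬ (1# ≈ 0#)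
    inverse      : ∀ x → ¬ (x ≈ 0#) → ∃ λ y → (x * y) ≈ 1#

  _<_ : Rel Carrier (ℓ₁ ⊔ ℓ₂)
  x < y = (x ≤ y) × ¬ (x ≈ y)

  2# : Carrier
  2# = 1# + 1#

  fromℕ : ℕ → Carrier
  fromℕ zero    = 0#
  fromℕ (suc n) = 1# + fromℕ n

  fromℤ : ℤ → Carrier
  fromℤ (+ n)      = fromℕ n
  fromℤ -[1+ n ]   = - fromℕ (suc n)

  IsCeiling : Carrier → ℤ → Set (ℓ₁ ⊔ ℓ₂)
  IsCeiling x k = ((fromℤ k - 1#) < x) × (x ≤ fromℤ k)

  sumOver : ∀ {n} → Subset n → (Fin n → Carrier) → Carrier
  sumOver {zero}  S f = 0#
  sumOver {suc n} S f with zero ∈? S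
  ... | yes _ = f zero + sumOver (Data.Vec.tail S) (λ i → f (suc i))
  ... | no  _ = sumOver (Data.Vec.tail S) (λ i → f (suc i))

-- Finite loopless multigraphs: vertices Fin n, edges Fin m, each edge
-- has two (distinct) ends.  Parallel edges are allowed.

record Graph : Set where
  field
    n    : ℕ
    m    : ℕ
    ends : Fin m → Fin n × Fin n
    loopless : ∀ e → proj₁ (ends e) ≢ proj₂ (ends e)

module _ (G : Graph) where
  open Graph G

  Joins : Fin m → Fin n → Fin n → Set
  Joins e u v = (ends e ≡ (u , v)) ⊎ (ends e ≡ (v , u))

  data Reach (W : Subset n) (A : Subset m) : Fin n → Fin n → Set where
    here : ∀ {u} → u ∈ W → Reach W A u u
    step : ∀ {u w v} e → u ∈ W → e ∈ A → Joins e u w → Reach W A w v → Reach W A u v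

  allV : Subset n
  allV = tabulate (λ _ → Data.Bool.true)

  allE : Subset m
  allE = tabulate (λ _ → Data.Bool.true)

  without : Subset m → Fin m → Subset m
  without A e = tabulate (λ f → isYes (f ∈? A) ∧ Data.Bool.not (isYes (f ≟ e)))

  Acyclic : Subset m → Set
  Acyclic A = ∀ e → e ∈ A → ¬ Reach allV (without A e) (proj₁ (ends e)) (proj₂ (ends e))

  ConnectedE : Subset m → Set
  ConnectedE A = ∀ u v → Reach allV A u v

  IsConnected : Set
  IsConnected = ConnectedE allE

  IsSpanningForest : Subset m → Set
  IsSpanningForest A = Acyclic A

  IsSpanningTree : Subset m → Set
  IsSpanningTree A = ConnectedE A × Acyclic A

  -- number of components of the induced subgraph G[W] is k:
  -- a surjective labelling of W by Fin k whose fibres are exactly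
  -- the connectivity classes of G[W]
  ComponentCount : Subset n → ℕ → Set
  ComponentCount W k =
    Σ ((v : Fin n) → v ∈ W → Fin k) λ c →
      (∀ i → ∃ λ v → Σ (v ∈ W) λ p → c v p ≡ i) ×
      (∀ u v (p : u ∈ W) (q : v ∈ W) →
         (c u p ≡ c v q → Reach W allE u v) × (Reach W allE u v → c u p ≡ c v q))

  -- d_A(v): number of edges of A incident with v (edges are loopless)
  incident : Fin n → Subset m
  incident v = tabulate (λ e → isYes (proj₁ (ends e) ≟ v) ∨ isYes (proj₂ (ends e) ≟ v))

  deg : Subset m → Fin n → ℕ
  deg A v = ∣ A ∩ incident v ∣

  eG : Subset n → ℕ
  eG S = ∣ tabulate (λ e → isYes (proj₁ (ends e) ∈? S) ∧ isYes (proj₂ (ends e) ∈? S)) ∣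

-- Among the spanning trees containing F take T of least total excess over b v = ⌈η v − λ⌉ + max {0, d_F(v) − 1} on X.
-- Starting from the vertices of X with d_T(v) ≥ b v, shrink S: as long as an edge of G ∖ S joins different components
-- of the forest obtained from T by deleting the edges outside F that meet S, adding it closes a cycle, and every vertex
-- of S on a deleted edge of that cycle can be relieved of one edge. If one of these exceeds its bound, the excess drops;
-- otherwise they all leave S. When this stops with positive excess, the components of G ∖ S can be counted through
-- the forest, giving Σ_S ⌈η v − λ⌉ + 2 ≤ ω(G ∖ S) + e_T(S) + |S|. Together with e_T(S) ≤ min {|S| − 1, e_G(S)} this
-- contradicts the hypothesis by exactly 1.
module Submission where

open import Defs
open import Level using (Level; 0ℓ)

-- Adding an edge `e₀` of the graph without S raises the degree at both of its ends. What protects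
-- their bounds is that every vertex outside S has a modification of T that leaves it strictly below
-- its bound if it belongs to X: T itself if it was never in S, otherwise the exchange by which it
-- left S. Both ends need their modifications at once, so each modification is confined to the
-- component of the remaining forest (the cell) that contains its vertex, and the ends of `e₀` lie
-- in different cells. Shrinking S only merges cells, so earlier modifications stay confined. A
-- modified edge set has to be connected but may contain cycles; extracting a spanning tree
-- afterwards only lowers degrees. In the count, the term max {0, d_F(v) - 1} makes F disappear: the
-- edges of F inside S and the vertices of S isolated in F account for extra components of the
-- forest, and the same two numbers recur in the degree sums and cancel. The 2 comes from two strict
-- inequalities: some vertex exceeds its bound, and a tree has fewer edges than vertices.

module BoundedDegreeTrees where
  open import Data.Nat using (ℕ; zero; suc; _+_; _*_; _∸_; _⊔_; _≤_; _<_; s≤s; z≤n; s≤s⁻¹)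
  import Data.Nat.Properties as ℕₚ
  open import Data.Nat.Induction using (<-wellFounded)
  open import Data.Nat.Solver using (module +-*-Solver)
  open import Induction.WellFounded using (Acc; acc)
  import Data.Integer as ℤ
  open import Data.Fin as Fin using (Fin; zero; suc; _≟_; join)
  open import Data.Fin.Properties using (any?; injective⇒≤; suc-injective; splitAt-join)
  open import Data.Fin.Subset using (Subset; _∈_; _∉_; _⊆_; _∪_; _∩_; ⁅_⁆; ∁; ∣_∣; inside; outside)
  open import Data.Fin.Subset.Properties
    using (_∈?_; drop-there; p⊆q⇒∣p∣≤∣q∣; p⊂q⇒∣p∣<∣q∣; ∣p∣≤n; x∈p∩q⁺; x∈p∩q⁻; x∈p∪q⁺; x∈p∪q⁻; x∈⁅x⁆; x∈⁅y⁆⇒x≡y;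
           ∣⁅x⁆∣≡1; x∈∁p⇒x∉p; x∉p⇒x∈∁p)
  open import Data.Vec using ([]; _∷_; here; there; tabulate)
  open import Data.Vec.Properties using (lookup⇒[]=; []=⇒lookup; lookup∘tabulate)
  open import Data.Bool using (Bool; T; not; if_then_else_)
  open import Data.Bool.Properties using (T-≡; T-∧; T-∨)
  open import Data.Product using (Σ; ∃; _×_; _,_; proj₁; proj₂; map₂)
  open import Data.Sum using (_⊎_; inj₁; inj₂; [_,_]′; swap) renaming (map to ⊎-map)
  open import Data.Sum.Properties using (inj₂-injective)
  open import Data.Empty using (⊥; ⊥-elim)
  open import Function using (_∘_; id; Injective)
  open import Function.Bundles using (Equivalence)
  open import Relation.Nullary using (¬_; Dec; yes; no; does; isYes; contradiction; ¬?)
  open import Relation.Nullary.Decidable using (toWitness; fromWitness; map′; _×-dec_; _⊎-dec_; decidable-stable)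
  open import Relation.Unary using (Pred; Decidable)
  open import Relation.Binary using (IsTotalOrder; Poset)
  import Relation.Binary.Reasoning.PartialOrder as ≤-Reasoning
  open import Relation.Binary.PropositionalEquality
    using (_≡_; _≢_; refl; sym; trans; cong; cong₂; subst; module ≡-Reasoning)
  open import Algebra.Properties.Semiring.Sum ℕₚ.+-*-semiring using (sum; sum-cong-≗; ∑-distrib-+; ∑-comm; *-distribˡ-sum)
  import Algebra.Solver.Ring.NaturalCoefficients.Default as SemiringSolver

  open Equivalence using (to; from)

  private variable
    n : ℕ
    P P₁ P₂ P₃ : Set

  -- Finite subsets: comprehension, ranks, cardinalities

  ∈-tabulate⁺ : {f : Fin n → Bool} → ∀ i → T (f i) → i ∈ tabulate f
  ∈-tabulate⁺ {f = f} i t = lookup⇒[]= i _ (trans (lookup∘tabulate f i) (to T-≡ t))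

  ∈-tabulate⁻ : {f : Fin n → Bool} → ∀ {i} → i ∈ tabulate f → T (f i)
  ∈-tabulate⁻ {f = f} {i} p = from T-≡ (trans (sym (lookup∘tabulate f i)) ([]=⇒lookup p))

  abstract
    -- Opaque, so that membership is handled only through the predicate and its decision procedure
    -- does not unfold.
    ⟪_⟫ : {P : Pred (Fin n) 0ℓ} → Decidable P → Subset n
    ⟪ P? ⟫ = tabulate (λ i → isYes (P? i))

    ∈-⟪⟫⁺ : {P : Pred (Fin n) 0ℓ} (P? : Decidable P) → ∀ {i} → P i → i ∈ ⟪ P? ⟫
    ∈-⟪⟫⁺ P? {i} p = ∈-tabulate⁺ i (fromWitness {a? = P? i} p)

    ∈-⟪⟫⁻ : {P : Pred (Fin n) 0ℓ} (P? : Decidable P) → ∀ {i} → i ∈ ⟪ P? ⟫ → P i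
    ∈-⟪⟫⁻ P? {i} p = toWitness {a? = P? i} (∈-tabulate⁻ p)

  -- The rank of a member within `A`: it turns injections into `A` into injections into `Fin ∣ A ∣`,
  -- and serves as a label later.
  index : (A : Subset n) → ∀ i → i ∈ A → Fin ∣ A ∣
  index (inside  ∷ A) zero    here      = zero
  index (inside  ∷ A) (suc i) (there p) = suc (index A i p)
  index (outside ∷ A) (suc i) (there p) = index A i p

  index-injective : (A : Subset n) → ∀ {i j} (p : i ∈ A) (q : j ∈ A) → index A i p ≡ index A j q → i ≡ j
  index-injective (inside  ∷ A) here      here      _  = refl
  index-injective (inside  ∷ A) (there p) (there q) eq = cong suc (index-injective A p q (suc-injective eq))
  index-injective (outside ∷ A) (there p) (there q) eq = cong suc (index-injective A p q eq)

  ∣∣>0⇒nonempty : (A : Subset n) → 0 < ∣ A ∣ → ∃ (_∈ A)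
  ∣∣>0⇒nonempty (inside  ∷ A) _ = zero , here
  ∣∣>0⇒nonempty (outside ∷ A) q = let i , i∈A = ∣∣>0⇒nonempty A q in suc i , there i∈A

  ∣p∪q∣≤∣p∣+∣q∣ : (p q : Subset n) → ∣ p ∪ q ∣ ≤ ∣ p ∣ + ∣ q ∣
  ∣p∪q∣≤∣p∣+∣q∣ []            []            = z≤n
  ∣p∪q∣≤∣p∣+∣q∣ (inside  ∷ p) (inside  ∷ q) =
    s≤s (ℕₚ.≤-trans (∣p∪q∣≤∣p∣+∣q∣ p q) (ℕₚ.+-monoʳ-≤ ∣ p ∣ (ℕₚ.n≤1+n ∣ q ∣)))
  ∣p∪q∣≤∣p∣+∣q∣ (inside  ∷ p) (outside ∷ q) = s≤s (∣p∪q∣≤∣p∣+∣q∣ p q)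
  ∣p∪q∣≤∣p∣+∣q∣ (outside ∷ p) (inside  ∷ q) =
    ℕₚ.≤-trans (s≤s (∣p∪q∣≤∣p∣+∣q∣ p q)) (ℕₚ.≤-reflexive (sym (ℕₚ.+-suc ∣ p ∣ ∣ q ∣)))
  ∣p∪q∣≤∣p∣+∣q∣ (outside ∷ p) (outside ∷ q) = ∣p∪q∣≤∣p∣+∣q∣ p q

  ⊆-∪⁅⁆⇒∣∣≤1+ : {p q : Subset n} (x : Fin n) → p ⊆ q ∪ ⁅ x ⁆ → ∣ p ∣ ≤ suc ∣ q ∣
  ⊆-∪⁅⁆⇒∣∣≤1+ {p = p} {q} x p⊆ = begin
    ∣ p ∣             ≤⟨ p⊆q⇒∣p∣≤∣q∣ p⊆ ⟩
    ∣ q ∪ ⁅ x ⁆ ∣     ≤⟨ ∣p∪q∣≤∣p∣+∣q∣ q ⁅ x ⁆ ⟩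
    ∣ q ∣ + ∣ ⁅ x ⁆ ∣ ≡⟨ cong (∣ q ∣ +_) (∣⁅x⁆∣≡1 x) ⟩
    ∣ q ∣ + 1         ≡⟨ ℕₚ.+-comm ∣ q ∣ 1 ⟩
    suc ∣ q ∣         ∎
    where open ℕₚ.≤-Reasoning

  -- Counting the classes of a decidable equivalence

  Labelling : (W : Subset n) → (Fin n → Fin n → Set) → ℕ → Set
  Labelling {n} W _∼_ k =
    Σ ((v : Fin n) → v ∈ W → Fin k) λ c →
      (∀ i → ∃ λ v → Σ (v ∈ W) λ p → c v p ≡ i) ×
      (∀ u v (p : u ∈ W) (q : v ∈ W) → (c u p ≡ c v q → u ∼ v) × (u ∼ v → c u p ≡ c v q))

  -- The relation is arbitrary because the induction drops the first vertex: reachability does not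
  -- restrict to reachability in a smaller graph, but an equivalence restricts to an equivalence.
  -- The first vertex joins the class of a related later member or opens a new class. For
  -- reachability, `Labelling` unfolds to `ComponentCount`.
  labelling : (W : Subset n) (_∼_ : Fin n → Fin n → Set) → (∀ u v → Dec (u ∼ v)) →
              (∀ {u} → u ∈ W → u ∼ u) → (∀ {u v} → u ∼ v → v ∼ u) →
              (∀ {u v w} → u ∼ v → v ∼ w → u ∼ w) → ∃ (Labelling W _∼_)
  labelling [] _ _ _ _ _ = 0 , (λ ()) , (λ ()) , (λ ())
  labelling (x ∷ W) _∼_ _∼?_ ∼-refl ∼-sym ∼-trans
    with labelling W (λ u v → suc u ∼ suc v) (λ u v → suc u ∼? suc v) (∼-refl ∘ there) ∼-sym ∼-trans
  labelling (outside ∷ W) _∼_ _ _ _ _ | k , c , onto , fibre = k , c′ , onto′ , fibre′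
    where
    c′ : ∀ v → v ∈ outside ∷ W → Fin k
    c′ (suc v) (there p) = c v p
    onto′ : ∀ i → ∃ λ v → Σ (v ∈ outside ∷ W) λ p → c′ v p ≡ i
    onto′ i = let v , p , eq = onto i in suc v , there p , eq
    fibre′ : ∀ u v p q → (c′ u p ≡ c′ v q → u ∼ v) × (u ∼ v → c′ u p ≡ c′ v q)
    fibre′ (suc u) (suc v) (there p) (there q) = fibre u v p q
  labelling {suc n} (inside ∷ W) _∼_ _∼?_ ∼-refl ∼-sym ∼-trans | k , c , onto , fibre
    with any? (λ i → (i ∈? W) ×-dec (zero ∼? suc i))
  ... | yes (j , j∈W , 0∼j) = k , c′ , onto′ , fibre′
    where
    c′ : ∀ v → v ∈ inside ∷ W → Fin k
    c′ zero    here      = c j j∈W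
    c′ (suc v) (there p) = c v p
    onto′ : ∀ i → ∃ λ v → Σ (v ∈ inside ∷ W) λ p → c′ v p ≡ i
    onto′ i = let v , p , eq = onto i in suc v , there p , eq
    fibre′ : ∀ u v p q → (c′ u p ≡ c′ v q → u ∼ v) × (u ∼ v → c′ u p ≡ c′ v q)
    fibre′ zero    zero    here      here      = (λ _ → ∼-refl here) , (λ _ → refl)
    fibre′ zero    (suc v) here      (there q) =
      (λ eq → ∼-trans 0∼j (proj₁ (fibre j v j∈W q) eq)) ,
      (λ 0∼v → proj₂ (fibre j v j∈W q) (∼-trans (∼-sym 0∼j) 0∼v))
    fibre′ (suc u) zero    (there p) here      =
      (λ eq → ∼-trans (proj₁ (fibre u j p j∈W) eq) (∼-sym 0∼j)) ,
      (λ u∼0 → proj₂ (fibre u j p j∈W) (∼-trans u∼0 0∼j))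
    fibre′ (suc u) (suc v) (there p) (there q) = fibre u v p q
  ... | no 0≁ = suc k , c′ , onto′ , fibre′
    where
    c′ : ∀ v → v ∈ inside ∷ W → Fin (suc k)
    c′ zero    here      = zero
    c′ (suc v) (there p) = suc (c v p)
    onto′ : ∀ i → ∃ λ v → Σ (v ∈ inside ∷ W) λ p → c′ v p ≡ i
    onto′ zero    = zero , here , refl
    onto′ (suc i) = let v , p , eq = onto i in suc v , there p , cong suc eq
    fibre′ : ∀ u v p q → (c′ u p ≡ c′ v q → u ∼ v) × (u ∼ v → c′ u p ≡ c′ v q)
    fibre′ zero    zero    here      here      = (λ _ → ∼-refl here) , (λ _ → refl)
    fibre′ zero    (suc v) here      (there q) = (λ ()) , (λ 0∼v → ⊥-elim (0≁ (v , q , 0∼v)))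
    fibre′ (suc u) zero    (there p) here      = (λ ()) , (λ u∼0 → ⊥-elim (0≁ (u , p , ∼-sym u∼0)))
    fibre′ (suc u) (suc v) (there p) (there q) =
      (λ eq → proj₁ (fibre u v p q) (suc-injective eq)) , (λ u∼v → cong suc (proj₂ (fibre u v p q) u∼v))

  -- Walks, forests and spanning trees in terms of edge sets

  module GraphLemmas (G : Graph) where
    open Graph G renaming (n to order; m to size)

    private variable
      W : Subset order
      A B : Subset size
      u v w : Fin order

    end₁ end₂ : Fin size → Fin order
    end₁ e = proj₁ (ends e)
    end₂ e = proj₂ (ends e)

    infix 4 _⊢_∼_
    _⊢_∼_ : Subset size → Fin order → Fin order → Set
    A ⊢ u ∼ v = Reach G (allV G) A u v

    Incident : Fin size → Fin order → Set
    Incident e v = end₁ e ≡ v ⊎ end₂ e ≡ v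

    ∈-allV : v ∈ allV G
    ∈-allV {v} = ∈-tabulate⁺ v _

    ∈-allE : ∀ {e} → e ∈ allE G
    ∈-allE {e} = ∈-tabulate⁺ e _

    infixl 6 _∖_
    _∖_ : Subset size → Fin size → Subset size
    _∖_ = without G

    ∈-∖⁺ : ∀ {e f} → f ∈ A → f ≢ e → f ∈ A ∖ e
    ∈-∖⁺ {A} {e} {f} f∈A f≢e = ∈-tabulate⁺ f
      (from T-∧ (fromWitness {a? = f ∈? A} f∈A , lemma (f ≟ e)))
      where
      lemma : (d : Dec (f ≡ e)) → T (not (isYes d))
      lemma (yes f≡e) = f≢e f≡e
      lemma (no _)    = _

    ∈-∖⁻ : ∀ {e f} → f ∈ A ∖ e → f ∈ A × f ≢ e
    ∈-∖⁻ {A} {e} {f} p with to T-∧ (∈-tabulate⁻ {i = f} p)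
    ... | t , t′ = toWitness {a? = f ∈? A} t , lemma (f ≟ e) t′
      where
      lemma : (d : Dec (f ≡ e)) → T (not (isYes d)) → f ≢ e
      lemma (no f≢e) _ = f≢e

    ∖-⊆ : ∀ e → A ∖ e ⊆ A
    ∖-⊆ e = proj₁ ∘ ∈-∖⁻

    ∖-mono : ∀ e → A ⊆ B → A ∖ e ⊆ B ∖ e
    ∖-mono e A⊆B p = let f∈A , f≢e = ∈-∖⁻ p in ∈-∖⁺ (A⊆B f∈A) f≢e

    ∣∖∣< : ∀ {e} → e ∈ A → ∣ A ∖ e ∣ < ∣ A ∣
    ∣∖∣< {e = e} e∈A = p⊂q⇒∣p∣<∣q∣ (∖-⊆ e , e , e∈A , λ p → proj₂ (∈-∖⁻ p) refl)

    ∣∣≤1+∣∖∣ : ∀ e → ∣ A ∣ ≤ suc ∣ A ∖ e ∣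
    ∣∣≤1+∣∖∣ {A} e = ⊆-∪⁅⁆⇒∣∣≤1+ {q = A ∖ e} e lemma
      where
      lemma : A ⊆ (A ∖ e) ∪ ⁅ e ⁆
      lemma {f} f∈A with f ≟ e
      ... | yes refl = x∈p∪q⁺ (inj₂ (x∈⁅x⁆ e))
      ... | no  f≢e  = x∈p∪q⁺ (inj₁ (∈-∖⁺ f∈A f≢e))

    ∈-incident⁺ : ∀ {e} → Incident e v → e ∈ incident G v
    ∈-incident⁺ {v} {e} i = ∈-tabulate⁺ e (from T-∨
      (⊎-map (fromWitness {a? = end₁ e ≟ v}) (fromWitness {a? = end₂ e ≟ v}) i))

    ∈-incident⁻ : ∀ {e} → e ∈ incident G v → Incident e v
    ∈-incident⁻ {v} {e} p =
      ⊎-map (toWitness {a? = end₁ e ≟ v}) (toWitness {a? = end₂ e ≟ v}) (to T-∨ (∈-tabulate⁻ p))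

    deg-mono : ∀ v → (∀ {e} → Incident e v → e ∈ A → e ∈ B) → deg G A v ≤ deg G B v
    deg-mono {A} {B} v A⊆B = p⊆q⇒∣p∣≤∣q∣ λ {e} p →
      let e∈A , e∈v = x∈p∩q⁻ A _ p in x∈p∩q⁺ (A⊆B (∈-incident⁻ e∈v) e∈A , e∈v)

    deg-⊆ : A ⊆ B → ∀ v → deg G A v ≤ deg G B v
    deg-⊆ A⊆B v = deg-mono v (λ _ → A⊆B)

    reach-source : Reach G W A u v → u ∈ W
    reach-source (here u∈W)         = u∈W
    reach-source (step _ u∈W _ _ _) = u∈W

    reach-trans : Reach G W A u v → Reach G W A v w → Reach G W A u w
    reach-trans (here _)             q = q
    reach-trans (step e u∈W e∈A j p) q = step e u∈W e∈A j (reach-trans p q)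

    reach-sym : Reach G W A u v → Reach G W A v u
    reach-sym (here u∈W)           = here u∈W
    reach-sym (step e u∈W e∈A j p) =
      reach-trans (reach-sym p) (step e (reach-source p) e∈A (swap j) (here u∈W))

    reach-edge : ∀ {e} → e ∈ A → end₁ e ∈ W → end₂ e ∈ W → Reach G W A (end₁ e) (end₂ e)
    reach-edge {e = e} e∈A p q = step e p e∈A (inj₁ refl) (here q)

    ∼-refl : A ⊢ u ∼ u
    ∼-refl = here ∈-allV

    ∼-edge : ∀ {e} → e ∈ A → A ⊢ end₁ e ∼ end₂ e
    ∼-edge e∈A = reach-edge e∈A ∈-allV ∈-allV

    -- Each edge of the walk is replaced by a walk in `B`; only edges with both ends in `W` occur on
    -- it, so only these are asked for.
    reach-closed : (∀ e → e ∈ A → end₁ e ∈ W → end₂ e ∈ W → B ⊢ end₁ e ∼ end₂ e) →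
                   Reach G W A u v → B ⊢ u ∼ v
    reach-closed h (here _) = ∼-refl
    reach-closed h (step e u∈W e∈A (inj₁ refl) p) =
      reach-trans (h e e∈A u∈W (reach-source p)) (reach-closed h p)
    reach-closed h (step e u∈W e∈A (inj₂ refl) p) =
      reach-trans (reach-sym (h e e∈A (reach-source p) u∈W)) (reach-closed h p)

    ∼-closed : (∀ {e} → e ∈ A → B ⊢ end₁ e ∼ end₂ e) → A ⊢ u ∼ v → B ⊢ u ∼ v
    ∼-closed h = reach-closed (λ _ e∈A _ _ → h e∈A)

    ∼-mono : A ⊆ B → A ⊢ u ∼ v → B ⊢ u ∼ v
    ∼-mono A⊆B = ∼-closed (∼-edge ∘ A⊆B)

    Through : (Fin order → Fin order → Set) → Fin size → Fin order → Fin order → Set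
    Through _∼_ e u v = (u ∼ end₁ e × end₂ e ∼ v) ⊎ (u ∼ end₂ e × end₁ e ∼ v)

    -- Of the rest of the walk only the stretch after its last crossing of `e` matters. It starts at
    -- an end of `e`, which, if the first step is `e` as well, is either the start itself or one
    -- crossing away from it.
    reach-split : ∀ e → Reach G W A u v →
                  Reach G W (A ∖ e) u v ⊎ Through (Reach G W (A ∖ e)) e u v
    reach-split e (here u∈W) = inj₁ (here u∈W)
    reach-split e (step f u∈W f∈A j p) with f ≟ e | reach-split e p
    ... | no f≢e  | inj₁ q              = inj₁ (step f u∈W (∈-∖⁺ f∈A f≢e) j q)
    ... | no f≢e  | inj₂ (inj₁ (q , r)) = inj₂ (inj₁ (step f u∈W (∈-∖⁺ f∈A f≢e) j q , r))
    ... | no f≢e  | inj₂ (inj₂ (q , r)) = inj₂ (inj₂ (step f u∈W (∈-∖⁺ f∈A f≢e) j q , r))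
    reach-split e (step f u∈W f∈A (inj₁ refl) p) | yes refl | inj₁ q              = inj₂ (inj₁ (here u∈W , q))
    reach-split e (step f u∈W f∈A (inj₁ refl) p) | yes refl | inj₂ (inj₁ (_ , r)) = inj₂ (inj₁ (here u∈W , r))
    reach-split e (step f u∈W f∈A (inj₁ refl) p) | yes refl | inj₂ (inj₂ (_ , r)) = inj₁ r
    reach-split e (step f u∈W f∈A (inj₂ refl) p) | yes refl | inj₁ q              = inj₂ (inj₂ (here u∈W , q))
    reach-split e (step f u∈W f∈A (inj₂ refl) p) | yes refl | inj₂ (inj₁ (_ , r)) = inj₁ r
    reach-split e (step f u∈W f∈A (inj₂ refl) p) | yes refl | inj₂ (inj₂ (_ , r)) = inj₂ (inj₂ (here u∈W , r))

    reach-⊆ : A ⊆ B → Reach G W A u v → Reach G W B u v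
    reach-⊆ A⊆B (here u∈W)           = here u∈W
    reach-⊆ A⊆B (step e u∈W e∈A j p) = step e u∈W (A⊆B e∈A) j (reach-⊆ A⊆B p)

    reach-join : ∀ {e} → e ∈ A → Through (Reach G W (A ∖ e)) e u v → Reach G W A u v
    reach-join {e = e} e∈A (inj₁ (p , q)) =
      reach-trans (reach-⊆ (∖-⊆ e) p)
        (step e (reach-source (reach-sym p)) e∈A (inj₁ refl) (reach-⊆ (∖-⊆ e) q))
    reach-join {e = e} e∈A (inj₂ (p , q)) =
      reach-trans (reach-⊆ (∖-⊆ e) p)
        (step e (reach-source (reach-sym p)) e∈A (inj₂ refl) (reach-⊆ (∖-⊆ e) q))

    private
      -- Deleting one edge `e` reduces a question about `A` to five questions about `A ∖ e`, by
      -- `reach-split` and `reach-join`.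
      reach-dec : ∀ k W A → ∣ A ∣ ≤ k → ∀ u v → Dec (Reach G W A u v)
      reach-dec k W A ∣A∣≤k u v with any? (_∈? A)
      ... | no empty = map′ (λ { (refl , u∈W) → here u∈W }) trivial ((u ≟ v) ×-dec (u ∈? W))
        where
        trivial : Reach G W A u v → u ≡ v × u ∈ W
        trivial (here u∈W)         = refl , u∈W
        trivial (step e _ e∈A _ _) = ⊥-elim (empty (e , e∈A))
      reach-dec zero    W A ∣A∣≤k u v | yes (e , e∈A) = contradiction (ℕₚ.<-≤-trans (∣∖∣< e∈A) ∣A∣≤k) (λ ())
      reach-dec (suc k) W A ∣A∣≤k u v | yes (e , e∈A) =
        map′ [ reach-⊆ (∖-⊆ e) , reach-join e∈A ]′ (reach-split e)
          (rec u v ⊎-dec ((rec u (end₁ e) ×-dec rec (end₂ e) v) ⊎-dec (rec u (end₂ e) ×-dec rec (end₁ e) v)))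
        where rec = reach-dec k W (A ∖ e) (s≤s⁻¹ (ℕₚ.<-≤-trans (∣∖∣< e∈A) ∣A∣≤k))

    abstract
      reach? : ∀ W A u v → Dec (Reach G W A u v)
      reach? W A = reach-dec ∣ A ∣ W A ℕₚ.≤-refl

    infix 4 _⊢_∼?_
    _⊢_∼?_ : ∀ A u v → Dec (A ⊢ u ∼ v)
    A ⊢ u ∼? v = reach? (allV G) A u v

    components : ∀ W → ∃ (ComponentCount G W)
    components W = labelling W (Reach G W (allE G)) (reach? W (allE G)) here reach-sym reach-trans

    ∼-empty : ¬ ∃ (_∈ A) → A ⊢ u ∼ v → u ≡ v
    ∼-empty empty (here _)           = refl
    ∼-empty empty (step e _ e∈A _ _) = ⊥-elim (empty (e , e∈A))

    private
      -- Deleting `e` can split only the component containing it; a fresh label for the side of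
      -- `end₂ e` keeps vertices of equal label connected. Without edges the labelling is injective.
      order≤labels : ∀ k {A p} → ∣ A ∣ ≤ k → (φ : Fin order → Fin p) →
                     (∀ u v → φ u ≡ φ v → A ⊢ u ∼ v) → order ≤ p + ∣ A ∣
      order≤labels k {A} {p} ∣A∣≤k φ sep with any? (_∈? A)
      ... | no empty = ℕₚ.≤-trans
        (injective⇒≤ {f = φ} (λ {u} {v} eq → ∼-empty empty (sep u v eq))) (ℕₚ.m≤m+n p _)
      order≤labels zero    ∣A∣≤k φ sep | yes (e , e∈A) = contradiction (ℕₚ.<-≤-trans (∣∖∣< e∈A) ∣A∣≤k) (λ ())
      order≤labels (suc k) {A} {p} ∣A∣≤k φ sep | yes (e , e∈A) = begin
        order                ≤⟨ order≤labels k (s≤s⁻¹ (ℕₚ.<-≤-trans (∣∖∣< e∈A) ∣A∣≤k)) φ′ sep′ ⟩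
        suc p + ∣ A ∖ e ∣    ≡⟨ ℕₚ.+-suc p _ ⟨
        p + suc ∣ A ∖ e ∣    ≤⟨ ℕₚ.+-monoʳ-≤ p (∣∖∣< e∈A) ⟩
        p + ∣ A ∣            ∎
        where
        open ℕₚ.≤-Reasoning
        φ″ : ∀ u → Dec (A ∖ e ⊢ u ∼ end₂ e) → Fin (suc p)
        φ″ u (yes _) = zero
        φ″ u (no _)  = suc (φ u)
        φ′ : Fin order → Fin (suc p)
        φ′ u = φ″ u (A ∖ e ⊢ u ∼? end₂ e)
        sep″ : ∀ u v (d : Dec (A ∖ e ⊢ u ∼ end₂ e)) (d′ : Dec (A ∖ e ⊢ v ∼ end₂ e)) →
               φ″ u d ≡ φ″ v d′ → A ∖ e ⊢ u ∼ v
        sep″ u v (yes p) (yes q) _ = reach-trans p (reach-sym q)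
        sep″ u v (no ¬p) (no ¬q) eq with reach-split e (sep u v (suc-injective eq))
        ... | inj₁ r              = r
        ... | inj₂ (inj₁ (_ , r)) = ⊥-elim (¬q (reach-sym r))
        ... | inj₂ (inj₂ (r , _)) = ⊥-elim (¬p r)
        sep′ : ∀ u v → φ′ u ≡ φ′ v → A ∖ e ⊢ u ∼ v
        sep′ u v = sep″ u v _ _

    order≤labels+edges : ∀ {p} → (φ : Fin order → Fin p) →
                         (∀ u v → φ u ≡ φ v → A ⊢ u ∼ v) → order ≤ p + ∣ A ∣
    order≤labels+edges = order≤labels _ ℕₚ.≤-refl

    acyclic-⊆ : A ⊆ B → Acyclic G B → Acyclic G A
    acyclic-⊆ A⊆B acyc e e∈A p = acyc e (A⊆B e∈A) (∼-mono (∖-mono e A⊆B) p)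

    private
      -- Deleting `e` from a forest separates its ends, so at least one of them is joined to no root
      -- and becomes a new one. Each step trades an edge for a root, until only distinct roots in
      -- `S` are left.
      roots+edges≤ : ∀ k {A S p} → ∣ A ∣ ≤ k → Acyclic G A →
                     (∀ {e} → e ∈ A → end₁ e ∈ S × end₂ e ∈ S) →
                     (ρ : Fin p → Fin order) → (∀ i → ρ i ∈ S) →
                     (∀ i j → A ⊢ ρ i ∼ ρ j → i ≡ j) → p + ∣ A ∣ ≤ ∣ S ∣
      roots+edges≤ zero {A} {S} {p} ∣A∣≤0 _ _ ρ ρ∈S sep = begin
        p + ∣ A ∣ ≡⟨ cong (p +_) (ℕₚ.n≤0⇒n≡0 ∣A∣≤0) ⟩
        p + 0     ≡⟨ ℕₚ.+-identityʳ p ⟩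
        p         ≤⟨ injective⇒≤ {f = λ i → index S (ρ i) (ρ∈S i)} inj ⟩
        ∣ S ∣     ∎
        where
        open ℕₚ.≤-Reasoning
        inj : Injective _≡_ _≡_ (λ i → index S (ρ i) (ρ∈S i))
        inj {i} {j} eq = sep i j (subst (A ⊢ ρ i ∼_) (index-injective S _ _ eq) ∼-refl)
      roots+edges≤ (suc k) {A} {S} {p} ∣A∣≤k acyc A⊆S ρ ρ∈S sep with any? (_∈? A)
      ... | no empty = roots+edges≤ zero ∣A∣≤0 acyc A⊆S ρ ρ∈S sep
        where
        ∣A∣≤0 : ∣ A ∣ ≤ 0
        ∣A∣≤0 = ℕₚ.≮⇒≥ (empty ∘ ∣∣>0⇒nonempty A)
      ... | yes (e , e∈A) = begin
        p + ∣ A ∣          ≤⟨ ℕₚ.+-monoʳ-≤ p (∣∣≤1+∣∖∣ e) ⟩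
        p + suc ∣ A ∖ e ∣  ≡⟨ ℕₚ.+-suc p _ ⟩
        suc p + ∣ A ∖ e ∣  ≤⟨ extend (any? (λ i → A ∖ e ⊢ ρ i ∼? end₁ e)) ⟩
        ∣ S ∣              ∎
        where
        open ℕₚ.≤-Reasoning
        add : ∀ v → v ∈ S → (∀ i → ¬ A ∖ e ⊢ ρ i ∼ v) → suc p + ∣ A ∖ e ∣ ≤ ∣ S ∣
        add v v∈S new = roots+edges≤ k (s≤s⁻¹ (ℕₚ.<-≤-trans (∣∖∣< e∈A) ∣A∣≤k))
          (acyclic-⊆ (∖-⊆ e) acyc) (A⊆S ∘ ∖-⊆ e) ρ′ ρ′∈S sep′
          where
          ρ′ : Fin (suc p) → Fin order
          ρ′ zero    = v
          ρ′ (suc i) = ρ i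
          ρ′∈S : ∀ i → ρ′ i ∈ S
          ρ′∈S zero    = v∈S
          ρ′∈S (suc i) = ρ∈S i
          sep′ : ∀ i j → A ∖ e ⊢ ρ′ i ∼ ρ′ j → i ≡ j
          sep′ zero    zero    _ = refl
          sep′ zero    (suc j) r = ⊥-elim (new j (reach-sym r))
          sep′ (suc i) zero    r = ⊥-elim (new i r)
          sep′ (suc i) (suc j) r = cong suc (sep i j (∼-mono (∖-⊆ e) r))
        extend : Dec (∃ λ i → A ∖ e ⊢ ρ i ∼ end₁ e) → suc p + ∣ A ∖ e ∣ ≤ ∣ S ∣
        extend (no none)     = add (end₁ e) (proj₁ (A⊆S e∈A)) (λ i r → none (i , r))
        extend (yes (i , r)) = add (end₂ e) (proj₂ (A⊆S e∈A)) λ j q →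
          let i≡j = sep i j (reach-join e∈A (inj₁ (r , reach-sym q)))
          in acyc e e∈A (reach-trans (reach-sym r) (subst (λ x → A ∖ e ⊢ ρ x ∼ end₂ e) (sym i≡j) q))

    acyclic⇒∣∣< : ∀ {A S} → Acyclic G A → (∀ {e} → e ∈ A → end₁ e ∈ S × end₂ e ∈ S) →
                  ∀ {v} → v ∈ S → ∣ A ∣ < ∣ S ∣
    acyclic⇒∣∣< acyc A⊆S {v} v∈S =
      roots+edges≤ _ {p = 1} ℕₚ.≤-refl acyc A⊆S (λ _ → v) (λ _ → v∈S) (λ { zero zero _ → refl })

    -- An inclusion-minimal joining edge set plays the role of a path: by minimality every
    -- connection within it crosses each of its edges.
    minimalPath : A ⊢ u ∼ v →
                  Σ (Subset size) λ Q → Q ⊆ A × Q ⊢ u ∼ v × (∀ {f} → f ∈ Q → Through (Q ∖ f ⊢_∼_) f u v)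
    minimalPath {A} {u} {v} p = go ∣ A ∣ A ℕₚ.≤-refl id p
      where
      go : ∀ k B → ∣ B ∣ ≤ k → B ⊆ A → B ⊢ u ∼ v →
           Σ (Subset size) λ Q → Q ⊆ A × Q ⊢ u ∼ v × (∀ {f} → f ∈ Q → Through (Q ∖ f ⊢_∼_) f u v)
      go k B ∣B∣≤k B⊆A p with any? (λ e → (e ∈? B) ×-dec (B ∖ e ⊢ u ∼? v))
      go k B ∣B∣≤k B⊆A p | no minimal = B , B⊆A , p , λ {f} f∈B →
        [ (λ q → ⊥-elim (minimal (f , f∈B , q))) , id ]′ (reach-split f p)
      go zero    B ∣B∣≤k B⊆A p | yes (e , e∈B , q) = contradiction (ℕₚ.<-≤-trans (∣∖∣< e∈B) ∣B∣≤k) (λ ())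
      go (suc k) B ∣B∣≤k B⊆A p | yes (e , e∈B , q) =
        go k (B ∖ e) (s≤s⁻¹ (ℕₚ.<-≤-trans (∣∖∣< e∈B) ∣B∣≤k)) (B⊆A ∘ ∖-⊆ e) q

    Through-mono : ∀ {e} → A ⊆ B → Through (A ⊢_∼_) e u v → Through (B ⊢_∼_) e u v
    Through-mono A⊆B = ⊎-map (λ (p , q) → ∼-mono A⊆B p , ∼-mono A⊆B q)
                             (λ (p , q) → ∼-mono A⊆B p , ∼-mono A⊆B q)

    -- The cycle exchange: the two pieces of the crossing, closed up by another connection of `u`
    -- and `v`, bypass `e`.
    Through⇒ends : ∀ {e} → Through (A ⊢_∼_) e u v → A ⊢ u ∼ v → A ⊢ end₁ e ∼ end₂ e
    Through⇒ends (inj₁ (p , q)) r = reach-trans (reach-sym p) (reach-trans r (reach-sym q))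
    Through⇒ends (inj₂ (p , q)) r = reach-trans q (reach-trans (reach-sym r) p)

    -- A cycle through an old edge `f` either avoids `e` and lies in `A`, or crosses `e`, and then
    -- going around it via `f` joins the ends of `e` within `A`.
    acyclic-∪⁅⁆ : ∀ {e} → Acyclic G A → ¬ A ⊢ end₁ e ∼ end₂ e → Acyclic G (A ∪ ⁅ e ⁆)
    acyclic-∪⁅⁆ {A} {e} acyc e≁ f f∈ p with f ≟ e
    ... | yes refl = e≁ (∼-mono (λ q → let g∈ , g≢f = ∈-∖⁻ q in
                          [ id , (λ r → contradiction (x∈⁅y⁆⇒x≡y e r) g≢f) ]′ (x∈p∪q⁻ A _ g∈)) p)
    ... | no f≢e = [ acyc f f∈A ∘ ∼-mono smaller , (λ t → e≁ (Through⇒ends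
                     (Through-mono (∖-⊆ f ∘ smaller) t) (∼-edge f∈A))) ]′ (reach-split e p)
      where
      f∈A : f ∈ A
      f∈A = [ id , (λ r → contradiction (x∈⁅y⁆⇒x≡y e r) f≢e) ]′ (x∈p∪q⁻ A _ f∈)
      smaller : (A ∪ ⁅ e ⁆) ∖ f ∖ e ⊆ A ∖ f
      smaller q = let g∈′ , g≢e = ∈-∖⁻ q ; g∈ , g≢f = ∈-∖⁻ g∈′ in
        ∈-∖⁺ ([ id , (λ r → contradiction (x∈⁅y⁆⇒x≡y e r) g≢e) ]′ (x∈p∪q⁻ A _ g∈)) g≢f

    -- Greedy: edges of `B` with ends not yet joined are added to `A`. This yields the initial tree
    -- and also recovers a tree from a connected modification.
    spanningTree : ConnectedE G B → A ⊆ B → Acyclic G A →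
                   Σ (Subset size) λ T → T ⊆ B × A ⊆ T × IsSpanningTree G T
    spanningTree {B} {A} conn A⊆B acyc = go size A (ℕₚ.m∸n≤m size ∣ A ∣) A⊆B acyc id
      where
      go : ∀ k C → size ∸ ∣ C ∣ ≤ k → C ⊆ B → Acyclic G C → A ⊆ C →
           Σ (Subset size) λ T → T ⊆ B × A ⊆ T × IsSpanningTree G T
      go k C bound C⊆B acyc A⊆C with any? (λ e → (e ∈? B) ×-dec ¬? (C ⊢ end₁ e ∼? end₂ e))
      ... | no none = C , C⊆B , A⊆C , (λ u v → ∼-closed
        (λ {e} e∈B → decidable-stable (C ⊢ end₁ e ∼? end₂ e) (λ e≁ → none (e , e∈B , e≁))) (conn u v)) , acyc
      go k C bound C⊆B acyc A⊆C | yes (e , e∈B , e≁) = continue k bound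
        where
        C⁺ = C ∪ ⁅ e ⁆
        e∈C⁺ : e ∈ C⁺
        e∈C⁺ = x∈p∪q⁺ (inj₂ (x∈⁅x⁆ e))
        C⊆C⁺ : C ⊆ C⁺
        C⊆C⁺ = x∈p∪q⁺ ∘ inj₁
        C⁺⊆B : C⁺ ⊆ B
        C⁺⊆B q = [ C⊆B , (λ r → subst (_∈ B) (sym (x∈⁅y⁆⇒x≡y e r)) e∈B) ]′ (x∈p∪q⁻ C _ q)
        decrease : size ∸ ∣ C⁺ ∣ < size ∸ ∣ C ∣
        decrease = ℕₚ.∸-monoʳ-< (p⊂q⇒∣p∣<∣q∣ (C⊆C⁺ , e , e∈C⁺ , λ e∈C → e≁ (∼-edge e∈C))) (∣p∣≤n C⁺)
        continue : ∀ k → size ∸ ∣ C ∣ ≤ k → _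
        continue zero    bound = contradiction (ℕₚ.<-≤-trans decrease bound) (λ ())
        continue (suc k) bound = go k C⁺ (s≤s⁻¹ (ℕₚ.<-≤-trans decrease bound)) C⁺⊆B
          (acyclic-∪⁅⁆ acyc e≁) (C⊆C⁺ ∘ A⊆C)

  -- The exchange argument for a fixed tree

  module Exchange (G : Graph) (F : Subset (Graph.m G)) (X : Subset (Graph.n G)) (b : Fin (Graph.n G) → ℕ)
                  (T : Subset (Graph.m G)) (F⊆T : F ⊆ T) (T-conn : ConnectedE G T) (T-acyc : Acyclic G T) where
    open Graph G renaming (n to order; m to size)
    open GraphLemmas G

    Avoids : Subset order → Fin size → Set
    Avoids S e = end₁ e ∉ S × end₂ e ∉ S

    avoids? : ∀ S e → Dec (Avoids S e)
    avoids? S e = ¬? (end₁ e ∈? S) ×-dec ¬? (end₂ e ∈? S)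

    avoids-incident : ∀ {S e v} → Avoids S e → Incident e v → v ∉ S
    avoids-incident (p , q) (inj₁ refl) = p
    avoids-incident (p , q) (inj₂ refl) = q

    kept? : ∀ S e → Dec (e ∈ T × (e ∈ F ⊎ Avoids S e))
    kept? S e = (e ∈? T) ×-dec ((e ∈? F) ⊎-dec avoids? S e)

    kept : Subset order → Subset size
    kept S = ⟪ kept? S ⟫

    ∈-kept⁻ : ∀ {S e} → e ∈ kept S → e ∈ T × (e ∈ F ⊎ Avoids S e)
    ∈-kept⁻ {S} = ∈-⟪⟫⁻ (kept? S)

    ∈-kept⁺ : ∀ {S e} → e ∈ T × (e ∈ F ⊎ Avoids S e) → e ∈ kept S
    ∈-kept⁺ {S} = ∈-⟪⟫⁺ (kept? S)

    kept-antitone : ∀ {S S′} → S′ ⊆ S → kept S ⊆ kept S′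
    kept-antitone S′⊆S p = let e∈T , q = ∈-kept⁻ p in
      ∈-kept⁺ (e∈T , ⊎-map id (λ (p , q) → p ∘ S′⊆S , q ∘ S′⊆S) q)

    Cell : Subset order → Fin order → Fin order → Set
    Cell S u v = kept S ⊢ u ∼ v

    Inside : Subset order → Fin order → Fin size → Set
    Inside S u e = Cell S u (end₁ e) × Cell S u (end₂ e)

    inside? : ∀ S u e → Dec (Inside S u e)
    inside? S u e = (kept S ⊢ u ∼? end₁ e) ×-dec (kept S ⊢ u ∼? end₂ e)

    inside-antitone : ∀ {S S′ u e} → S′ ⊆ S → Inside S u e → Inside S′ u e
    inside-antitone S′⊆S (p , q) = ∼-mono (kept-antitone S′⊆S) p , ∼-mono (kept-antitone S′⊆S) q

    inside-incident : ∀ {S u e v} → Inside S u e → Incident e v → Cell S u v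
    inside-incident (p , q) (inj₁ refl) = p
    inside-incident (p , q) (inj₂ refl) = q

    inside-shift : ∀ {S u w e} → Cell S u w → Inside S w e → Inside S u e
    inside-shift r (p , q) = reach-trans r p , reach-trans r q

    within? : ∀ H S u e → Dec (e ∈ H × Inside S u e)
    within? H S u e = (e ∈? H) ×-dec inside? S u e

    within : Subset size → Subset order → Fin order → Subset size
    within H S u = ⟪ within? H S u ⟫

    -- H differs from T only inside the cell of u and still joins, inside that cell, the ends of every edge of T there;
    -- hence modifications in different cells can be combined.
    record Modification (S : Subset order) (u : Fin order) : Set where
      field
        H       : Subset size
        F⊆H     : F ⊆ H
        local   : ∀ e → ¬ Inside S u e → (e ∈ H → e ∈ T) × (e ∈ T → e ∈ H)
        joined  : ∀ e → e ∈ T → Inside S u e → within H S u ⊢ end₁ e ∼ end₂ e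
        bounded : ∀ v → v ∈ X → deg G H v ≤ b v ⊔ deg G T v

      connected : ConnectedE G H
      connected v w = ∼-closed edge (T-conn v w)
        where
        edge : ∀ {e} → e ∈ T → H ⊢ end₁ e ∼ end₂ e
        edge {e} e∈T with inside? S u e
        ... | yes ins = ∼-mono (proj₁ ∘ ∈-⟪⟫⁻ (within? H S u)) (joined e e∈T ins)
        ... | no ¬ins = ∼-edge (proj₂ (local e ¬ins) e∈T)

    open Modification

    unmodified : ∀ {S u} → Modification S u
    unmodified .H               = T
    unmodified .F⊆H             = F⊆T
    unmodified .local _ _       = id , id
    unmodified {S} {u} .joined e e∈T ins = ∼-edge (∈-⟪⟫⁺ (within? T S u) (e∈T , ins))
    unmodified .bounded v _     = ℕₚ.m≤n⊔m (b v) _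

    -- Shrinking `S` enlarges `kept`, so a change inside the old cell is inside the new one. An edge
    -- of `T` inside the new cell only is still present and joins its own ends.
    widen : ∀ {S S′ u} → S′ ⊆ S → Modification S u → Modification S′ u
    widen S′⊆S M .H         = M .H
    widen S′⊆S M .F⊆H       = M .F⊆H
    widen S′⊆S M .local e ¬ins = M .local e (¬ins ∘ inside-antitone S′⊆S)
    widen {S} {S′} {u} S′⊆S M .joined e e∈T ins′ with inside? S u e
    ... | yes ins = ∼-mono (λ p → let g∈H , g-ins = ∈-⟪⟫⁻ (within? (M .H) S u) p in
                      ∈-⟪⟫⁺ (within? (M .H) S′ u) (g∈H , inside-antitone S′⊆S g-ins)) (M .joined e e∈T ins)
    ... | no ¬ins = ∼-edge (∈-⟪⟫⁺ (within? (M .H) S′ u) (proj₂ (M .local e ¬ins) e∈T , ins′))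
    widen S′⊆S M .bounded   = M .bounded

    -- Vacuous outside `X`, where degrees are unrestricted; thus every vertex outside `S` can have a
    -- relief.
    Relieves : ∀ {S u} → Modification S u → Set
    Relieves {u = u} M = u ∈ X → deg G (M .H) u < b u

    Relief : Subset order → Fin order → Set
    Relief S u = Σ (Modification S u) Relieves

    -- A single exchange: both reliefs are carried out, then the path edge `f` at `u` is replaced by
    -- `e₀`. The reliefs pay for `e₀` at its ends, and the loss of `f` benefits `u`.
    module Swap
      {S S′ : Subset order} {Q : Subset size} (S⊆X : S ⊆ X) (S′⊆S : S′ ⊆ S)
      {e₀ : Fin size} (e₀-avoids : Avoids S e₀) (apart : ¬ kept S ⊢ end₁ e₀ ∼ end₂ e₀)
      (relief₁ : Relief S (end₁ e₀)) (relief₂ : Relief S (end₂ e₀))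
      (Q⊆kept : Q ⊆ kept S′) (Q-path : ∀ {g} → g ∈ Q → Through (Q ∖ g ⊢_∼_) g (end₁ e₀) (end₂ e₀))
      {f : Fin size} (f∈Q : f ∈ Q) (f∉F : f ∉ F) {u : Fin order} (u∈S : u ∈ S) (f-u : Incident f u) where

      private
        x = end₁ e₀
        y = end₂ e₀
        M₁ = proj₁ relief₁
        M₂ = proj₁ relief₂

      -- `M₁` decides in the cell of `x` and `M₂` everywhere else; as `M₂` agrees with `T` outside
      -- the cell of `y`, the result is `T` changed in both cells at once.
      combined? : ∀ e → Dec ((Inside S x e × e ∈ M₁ .H) ⊎ (¬ Inside S x e × e ∈ M₂ .H))
      combined? e = (inside? S x e ×-dec (e ∈? M₁ .H)) ⊎-dec (¬? (inside? S x e) ×-dec (e ∈? M₂ .H))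

      combined : Subset size
      combined = ⟪ combined? ⟫

      swapped? : ∀ e → Dec ((e ∈ combined × e ≢ f) ⊎ e ≡ e₀)
      swapped? e = ((e ∈? combined) ×-dec ¬? (e ≟ f)) ⊎-dec (e ≟ e₀)

      swapped : Subset size
      swapped = ⟪ swapped? ⟫

      disjoint : ∀ {v} → Cell S x v → Cell S y v → ⊥
      disjoint p q = apart (reach-trans p (reach-sym q))

      f∈T : f ∈ T
      f∈T = proj₁ (∈-kept⁻ {S′} (Q⊆kept f∈Q))

      f∉kept : f ∉ kept S
      f∉kept p = [ f∉F , (λ av → avoids-incident av f-u u∈S) ]′ (proj₂ (∈-kept⁻ p))

      -- `f` is not in `kept S`, since it lies outside `F` and meets `S`. If a cell contained both
      -- of its ends, `f` would close a cycle in `T`.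
      f-outside : ∀ {w} → ¬ Inside S w f
      f-outside (p , q) = T-acyc f f∈T (∼-mono
        (λ g∈ → ∈-∖⁺ (proj₁ (∈-kept⁻ {S} g∈)) (λ { refl → f∉kept g∈ })) (reach-trans (reach-sym p) q))

      combined-outside : ∀ {e} → ¬ Inside S x e → ¬ Inside S y e → (e ∈ combined → e ∈ T) × (e ∈ T → e ∈ combined)
      combined-outside {e} ¬x ¬y =
        (λ p → [ (λ (x , _) → ⊥-elim (¬x x)) , (λ (_ , q) → proj₁ (M₂ .local e ¬y) q) ]′ (∈-⟪⟫⁻ combined? p)) ,
        (λ e∈T → ∈-⟪⟫⁺ combined? (inj₂ (¬x , proj₂ (M₂ .local e ¬y) e∈T)))

      -- The piece of the path before `g` joins `x` to an end of `g`, so the whole path lies in one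
      -- cell of `S′`.
      x-near : ∀ {g} → g ∈ Q → Inside S′ x g
      x-near {g} g∈Q with Q-path g∈Q
      ... | inj₁ (p , _) = let r = ∼-mono (Q⊆kept ∘ ∖-⊆ g) p in r , reach-trans r (∼-edge (Q⊆kept g∈Q))
      ... | inj₂ (p , _) = let r = ∼-mono (Q⊆kept ∘ ∖-⊆ g) p in reach-trans r (reach-sym (∼-edge (Q⊆kept g∈Q))) , r

      u∼x : Cell S′ u x
      u∼x = reach-sym (inside-incident (x-near f∈Q) f-u)

      u∼y : Cell S′ u y
      u∼y with Q-path f∈Q
      ... | inj₁ (_ , p) = reach-trans u∼x (reach-trans (proj₂ (x-near f∈Q)) (∼-mono (Q⊆kept ∘ ∖-⊆ f) p))
      ... | inj₂ (_ , p) = reach-trans u∼x (reach-trans (proj₁ (x-near f∈Q)) (∼-mono (Q⊆kept ∘ ∖-⊆ f) p))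

      inside-x : ∀ {e} → Inside S x e → Inside S′ u e
      inside-x ins = inside-shift u∼x (inside-antitone S′⊆S ins)

      inside-y : ∀ {e} → Inside S y e → Inside S′ u e
      inside-y ins = inside-shift u∼y (inside-antitone S′⊆S ins)

      F⊆swapped : F ⊆ swapped
      F⊆swapped {e} e∈F = ∈-⟪⟫⁺ swapped? (inj₁ (∈-⟪⟫⁺ combined? (case (inside? S x e)) , λ { refl → f∉F e∈F }))
        where
        case : Dec (Inside S x e) → _
        case (yes ins) = inj₁ (ins , M₁ .F⊆H e∈F)
        case (no ¬ins) = inj₂ (¬ins , M₂ .F⊆H e∈F)

      swapped-local : ∀ e → ¬ Inside S′ u e → (e ∈ swapped → e ∈ T) × (e ∈ T → e ∈ swapped)
      swapped-local e ¬ins =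
        (λ p → [ proj₁ outside-eq ∘ proj₁ , (λ { refl → ⊥-elim (¬ins (u∼x , u∼y)) }) ]′ (∈-⟪⟫⁻ swapped? p)) ,
        (λ e∈T → ∈-⟪⟫⁺ swapped? (inj₁ (proj₂ outside-eq e∈T , λ { refl → ¬ins (inside-shift u∼x (x-near f∈Q)) })))
        where outside-eq = combined-outside (¬ins ∘ inside-x) (¬ins ∘ inside-y)

      private
        N = within swapped S′ u

        N⁺ : ∀ {g} → g ∈ combined → g ≢ f → Inside S′ u g → g ∈ N
        N⁺ p q ins = ∈-⟪⟫⁺ (within? swapped S′ u) (∈-⟪⟫⁺ swapped? (inj₁ (p , q)) , ins)

        N₁ : within (M₁ .H) S x ⊆ N
        N₁ p = let g∈H , ins = ∈-⟪⟫⁻ (within? (M₁ .H) S x) p in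
          N⁺ (∈-⟪⟫⁺ combined? (inj₁ (ins , g∈H))) (λ { refl → f-outside ins }) (inside-x ins)

        N₂ : within (M₂ .H) S y ⊆ N
        N₂ p = let g∈H , ins = ∈-⟪⟫⁻ (within? (M₂ .H) S y) p in
          N⁺ (∈-⟪⟫⁺ combined? (inj₂ ((λ ins′ → disjoint (proj₁ ins′) (proj₁ ins)) , g∈H)))
             (λ { refl → f-outside ins }) (inside-y ins)

        -- Three regions: `M₁` takes care of the cell of `x`, `M₂` of the cell of `y`, and outside
        -- both `T` is unchanged.
        joined-≢f : ∀ {e} → e ∈ T → e ≢ f → Inside S′ u e → N ⊢ end₁ e ∼ end₂ e
        joined-≢f {e} e∈T e≢f ins = cases (inside? S x e) (inside? S y e)
          where
          cases : Dec (Inside S x e) → Dec (Inside S y e) → N ⊢ end₁ e ∼ end₂ e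
          cases (yes p) _       = ∼-mono N₁ (M₁ .joined e e∈T p)
          cases (no _)  (yes q) = ∼-mono N₂ (M₂ .joined e e∈T q)
          cases (no ¬p) (no ¬q) = ∼-edge (N⁺ (proj₂ (combined-outside ¬p ¬q) e∈T) e≢f ins)

        joined-Q : ∀ {v w} → Q ∖ f ⊢ v ∼ w → N ⊢ v ∼ w
        joined-Q = ∼-closed λ p → let g∈Q , g≢f = ∈-∖⁻ p in
          joined-≢f (proj₁ (∈-kept⁻ {S′} (Q⊆kept g∈Q))) g≢f (inside-shift u∼x (x-near g∈Q))

      swapped-joined : ∀ e → e ∈ T → Inside S′ u e → N ⊢ end₁ e ∼ end₂ e
      swapped-joined e e∈T ins = cases (e ≟ f)
        where
        joined-f : N ⊢ end₁ f ∼ end₂ f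
        -- The bypass of `f` runs along the two pieces of `Q ∖ f` and through `e₀`, every path edge
        -- being replaced by a connection that survives.
        joined-f = Through⇒ends
          (⊎-map (λ (p , q) → joined-Q p , joined-Q q) (λ (p , q) → joined-Q p , joined-Q q) (Q-path f∈Q))
          (∼-edge (∈-⟪⟫⁺ (within? swapped S′ u) (∈-⟪⟫⁺ swapped? (inj₂ refl) , (u∼x , u∼y))))
        cases : Dec (e ≡ f) → N ⊢ end₁ e ∼ end₂ e
        cases (no e≢f)  = joined-≢f e∈T e≢f ins
        cases (yes e≡f) = subst (λ g → N ⊢ end₁ g ∼ end₂ g) (sym e≡f) joined-f

      -- An edge at `v` that is not inside the cell of `x` is not inside that of `y` either, the
      -- cells being disjoint; on it `M₂`, `T` and `M₁` agree.
      combined-deg₁ : ∀ {v} → Cell S x v → deg G combined v ≤ deg G (M₁ .H) v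
      combined-deg₁ {v} v∈x = deg-mono v λ {e} e-v p → [ proj₂ , (λ (¬x , e∈H₂) →
        proj₂ (M₁ .local e ¬x) (proj₁ (M₂ .local e (λ y → disjoint v∈x (inside-incident y e-v))) e∈H₂)) ]′
        (∈-⟪⟫⁻ combined? p)

      combined-deg₂ : ∀ {v} → ¬ Cell S x v → deg G combined v ≤ deg G (M₂ .H) v
      combined-deg₂ {v} v∉x = deg-mono v λ e-v p →
        [ (λ (ins , _) → ⊥-elim (v∉x (inside-incident ins e-v))) , proj₂ ]′ (∈-⟪⟫⁻ combined? p)

      combined-bounded : ∀ v → v ∈ X → deg G combined v ≤ b v ⊔ deg G T v
      combined-bounded v v∈X with kept S ⊢ x ∼? v
      ... | yes p = ℕₚ.≤-trans (combined-deg₁ p) (M₁ .bounded v v∈X)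
      ... | no ¬p = ℕₚ.≤-trans (combined-deg₂ ¬p) (M₂ .bounded v v∈X)

      swapped-deg-≤1+ : ∀ v → deg G swapped v ≤ suc (deg G combined v)
      swapped-deg-≤1+ v = ⊆-∪⁅⁆⇒∣∣≤1+ e₀ λ {e} p → let q , r = x∈p∩q⁻ swapped _ p in
        [ (λ (s , _) → x∈p∪q⁺ (inj₁ (x∈p∩q⁺ (s , r)))) , (λ { refl → x∈p∪q⁺ (inj₂ (x∈⁅x⁆ e₀)) }) ]′ (∈-⟪⟫⁻ swapped? q)

      swapped-∈ : ∀ {v e} → v ≢ x → v ≢ y → Incident e v → e ∈ swapped → e ∈ combined × e ≢ f
      swapped-∈ v≢x v≢y e-v p with ∈-⟪⟫⁻ swapped? p | e-v
      ... | inj₁ q    | _         = q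
      ... | inj₂ refl | inj₁ refl = ⊥-elim (v≢x refl)
      ... | inj₂ refl | inj₂ refl = ⊥-elim (v≢y refl)

      -- At either end of `e₀` the relief leaves room for exactly one more edge; at all other
      -- vertices `e₀` adds nothing.
      swapped-bounded : ∀ v → v ∈ X → deg G swapped v ≤ b v ⊔ deg G T v
      swapped-bounded v v∈X with v ≟ x | v ≟ y
      ... | yes refl | _        = begin
        deg G swapped x         ≤⟨ swapped-deg-≤1+ x ⟩
        suc (deg G combined x)  ≤⟨ s≤s (combined-deg₁ ∼-refl) ⟩
        suc (deg G (M₁ .H) x)   ≤⟨ proj₂ relief₁ v∈X ⟩
        b x                     ≤⟨ ℕₚ.m≤m⊔n (b x) _ ⟩
        b x ⊔ deg G T x         ∎
        where open ℕₚ.≤-Reasoning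
      ... | no _     | yes refl = begin
        deg G swapped y         ≤⟨ swapped-deg-≤1+ y ⟩
        suc (deg G combined y)  ≤⟨ s≤s (combined-deg₂ apart) ⟩
        suc (deg G (M₂ .H) y)   ≤⟨ proj₂ relief₂ v∈X ⟩
        b y                     ≤⟨ ℕₚ.m≤m⊔n (b y) _ ⟩
        b y ⊔ deg G T y         ∎
        where open ℕₚ.≤-Reasoning
      ... | no v≢x   | no v≢y   =
        ℕₚ.≤-trans (deg-mono v (λ e-v → proj₁ ∘ swapped-∈ v≢x v≢y e-v)) (combined-bounded v v∈X)

      -- As `e₀` avoids `S`, the vertex `u` gains nothing and loses `f`. The maximum serves both
      -- outcomes: an overfull `u` falls below its degree in `T`, any other `u` below `b u`.
      swapped-deg-u : deg G swapped u < b u ⊔ deg G T u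
      swapped-deg-u = ℕₚ.<-≤-trans (p⊂q⇒∣p∣<∣q∣ (smaller , f , x∈p∩q⁺ (f∈combined , ∈-incident⁺ f-u) , missing))
                                   (combined-bounded u (S⊆X u∈S))
        where
        in-swapped : ∀ {e} → e ∈ swapped ∩ incident G u → e ∈ combined × e ≢ f
        in-swapped p = let q , r = x∈p∩q⁻ swapped _ p in
          swapped-∈ (λ { refl → proj₁ e₀-avoids u∈S }) (λ { refl → proj₂ e₀-avoids u∈S }) (∈-incident⁻ r) q
        smaller : swapped ∩ incident G u ⊆ combined ∩ incident G u
        smaller p = x∈p∩q⁺ (proj₁ (in-swapped p) , proj₂ (x∈p∩q⁻ swapped _ p))
        f∈combined : f ∈ combined
        f∈combined = proj₂ (combined-outside f-outside f-outside) f∈T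
        missing : f ∉ swapped ∩ incident G u
        missing p = proj₂ (in-swapped p) refl

      modification : Modification S′ u
      modification .H       = swapped
      modification .F⊆H     = F⊆swapped
      modification .local   = swapped-local
      modification .joined  = swapped-joined
      modification .bounded = swapped-bounded

    Improvement : Set
    Improvement = Σ (Subset size) λ H → F ⊆ H × ConnectedE G H ×
      (∀ v → v ∈ X → deg G H v ≤ b v ⊔ deg G T v) ×
      ∃ λ v → v ∈ X × b v < deg G T v × deg G H v < deg G T v

    record Obstruction : Set where
      field
        S        : Subset order
        S⊆X      : S ⊆ X
        tight    : ∀ v → v ∈ S → b v ≤ deg G T v
        overfull : ∀ v → v ∈ X → b v < deg G T v → v ∈ S
        closed   : ∀ e → Avoids S e → kept S ⊢ end₁ e ∼ end₂ e

    private
      shrink : ∀ k S → ∣ S ∣ ≤ k → S ⊆ X → (∀ v → v ∈ S → b v ≤ deg G T v) →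
               (∀ v → v ∈ X → b v < deg G T v → v ∈ S) → (∀ u → u ∉ S → Relief S u) →
               Improvement ⊎ Obstruction
      shrink k S ∣S∣≤k S⊆X tight overfull relief
        with any? (λ e → avoids? S e ×-dec ¬? (kept S ⊢ end₁ e ∼? end₂ e))
      ... | no none = inj₂ record
        { S = S ; S⊆X = S⊆X ; tight = tight ; overfull = overfull
        ; closed = λ e av → decidable-stable (kept S ⊢ end₁ e ∼? end₂ e) (λ e≁ → none (e , av , e≁)) }
      ... | yes (e₀ , av , apart) with minimalPath (T-conn (end₁ e₀) (end₂ e₀))
      ... | Q , Q⊆T , Q∼ , Q-path = conclude any-overfull
        where
        Hit : Fin order → Set
        Hit s = ∃ λ f → f ∈ Q × f ∉ F × Incident f s

        hit? : ∀ s → Dec (Hit s)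
        hit? s = any? λ f → (f ∈? Q) ×-dec (¬? (f ∈? F) ×-dec ((end₁ f ≟ s) ⊎-dec (end₂ f ≟ s)))

        unhit? : ∀ s → Dec (s ∈ S × ¬ Hit s)
        unhit? s = (s ∈? S) ×-dec ¬? (hit? s)

        -- Discarding all hit vertices at once puts the whole path into `kept S′`, so that it lies
        -- in a single cell there.
        S′ : Subset order
        S′ = ⟪ unhit? ⟫

        S′⊆S : S′ ⊆ S
        S′⊆S = proj₁ ∘ ∈-⟪⟫⁻ unhit?

        Q⊆kept : Q ⊆ kept S′
        Q⊆kept {g} g∈Q with g ∈? F
        ... | yes g∈F = ∈-kept⁺ (Q⊆T g∈Q , inj₁ g∈F)
        ... | no  g∉F = ∈-kept⁺ (Q⊆T g∈Q , inj₂
          ( (λ p → proj₂ (∈-⟪⟫⁻ unhit? p) (g , g∈Q , g∉F , inj₁ refl))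
          , (λ p → proj₂ (∈-⟪⟫⁻ unhit? p) (g , g∈Q , g∉F , inj₂ refl))))

        module At {u} (u∈S : u ∈ S) (hit : Hit u) =
          Swap S⊆X S′⊆S av apart (relief _ (proj₁ av)) (relief _ (proj₂ av)) Q⊆kept Q-path
               (proj₁ (proj₂ hit)) (proj₁ (proj₂ (proj₂ hit))) u∈S (proj₂ (proj₂ (proj₂ hit)))

        any-overfull : Dec (∃ λ s → s ∈ S × Hit s × b s < deg G T s)
        any-overfull = any? λ s → (s ∈? S) ×-dec (hit? s ×-dec (b s ℕₚ.<? deg G T s))

        -- Were no vertex of `S` hit, the path would lie in `kept S` and join the ends of `e₀`,
        -- against `apart`. Hence `S` really shrinks.
        some-hit : ∃ λ s → s ∈ S × Hit s
        some-hit = decidable-stable (any? λ s → (s ∈? S) ×-dec hit? s) λ none → apart (∼-mono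
          (λ g∈Q → let g∈T , c = ∈-kept⁻ (Q⊆kept g∈Q) in ∈-kept⁺ (g∈T , ⊎-map id (λ (p , q) →
            (λ r → p (∈-⟪⟫⁺ unhit? (r , λ h → none (_ , r , h)))) ,
            (λ r → q (∈-⟪⟫⁺ unhit? (r , λ h → none (_ , r , h))))) c)) Q∼)

        smaller : ∣ S′ ∣ < ∣ S ∣
        smaller = let s , s∈S , hit = some-hit in
          p⊂q⇒∣p∣<∣q∣ (S′⊆S , s , s∈S , λ p → proj₂ (∈-⟪⟫⁻ unhit? p) hit)

        conclude : Dec (∃ λ s → s ∈ S × Hit s × b s < deg G T s) → Improvement ⊎ Obstruction
        conclude (yes (s , s∈S , hit , over)) = inj₁
          (swapped , F⊆swapped , connected modification , swapped-bounded , s , S⊆X s∈S , over ,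
           subst (deg G swapped s <_) (ℕₚ.m≤n⇒m⊔n≡n (ℕₚ.<⇒≤ over)) swapped-deg-u)
          where open At s∈S hit
        conclude (no ¬over) = descend k ∣S∣≤k
          where
          relief′ : ∀ u → u ∉ S′ → Relief S′ u
          relief′ u u∉S′ with u ∈? S
          ... | no u∉S = let M , r = relief u u∉S in widen S′⊆S M , r
          ... | yes u∈S = modification , λ _ → subst (deg G swapped u <_)
                (ℕₚ.m≥n⇒m⊔n≡m (ℕₚ.≮⇒≥ (λ over → ¬over (u , u∈S , hit , over)))) swapped-deg-u
            where
            hit : Hit u
            hit = decidable-stable (hit? u) (λ ¬hit → u∉S′ (∈-⟪⟫⁺ unhit? (u∈S , ¬hit)))
            open At u∈S hit
          descend : ∀ k → ∣ S ∣ ≤ k → Improvement ⊎ Obstruction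
          descend zero    ∣S∣≤0 = contradiction (ℕₚ.<-≤-trans smaller ∣S∣≤0) (λ ())
          descend (suc k) ∣S∣≤k = shrink k S′ (s≤s⁻¹ (ℕₚ.<-≤-trans smaller ∣S∣≤k)) (S⊆X ∘ S′⊆S)
            (λ v → tight v ∘ S′⊆S)
            (λ v v∈X over → ∈-⟪⟫⁺ unhit? (overfull v v∈X over , λ hit → ¬over (v , overfull v v∈X over , hit , over)))
            relief′

    improve-or-obstruct : Improvement ⊎ Obstruction
    improve-or-obstruct = shrink order S (∣p∣≤n S) (proj₁ ∘ S⁻) (λ v → proj₂ ∘ S⁻)
      (λ v v∈X over → ∈-⟪⟫⁺ saturated? (v∈X , ℕₚ.<⇒≤ over))
      -- A vertex outside the initial set is outside `X` or already has room in `T`.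
      (λ u u∉S → unmodified , λ u∈X → ℕₚ.≰⇒> (λ b≤deg → u∉S (∈-⟪⟫⁺ saturated? (u∈X , b≤deg))))
      where
      saturated? : ∀ v → Dec (v ∈ X × b v ≤ deg G T v)
      saturated? v = (v ∈? X) ×-dec (b v ℕₚ.≤? deg G T v)
      S : Subset order
      S = ⟪ saturated? ⟫
      S⁻ : ∀ {v} → v ∈ S → v ∈ X × b v ≤ deg G T v
      S⁻ = ∈-⟪⟫⁻ saturated?

  -- Sums of indicators

  χ : Dec P → ℕ
  χ P? = if does P? then 1 else 0

  sum-mono-≤ : {f g : Fin n → ℕ} → (∀ i → f i ≤ g i) → sum f ≤ sum g
  sum-mono-≤ {zero}  f≤g = z≤n
  sum-mono-≤ {suc n} f≤g = ℕₚ.+-mono-≤ (f≤g zero) (sum-mono-≤ (f≤g ∘ suc))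

  sum-mono-< : {f g : Fin n → ℕ} → (∀ i → f i ≤ g i) → ∀ i → f i < g i → sum f < sum g
  sum-mono-< f≤g zero    f<g = ℕₚ.+-mono-<-≤ f<g (sum-mono-≤ (f≤g ∘ suc))
  sum-mono-< f≤g (suc i) f<g = ℕₚ.+-mono-≤-< (f≤g zero) (sum-mono-< (f≤g ∘ suc) i f<g)

  sum-*χ≟ : (g : Fin n → ℕ) → ∀ i → sum (λ j → g j * χ (i ≟ j)) ≡ g i
  sum-*χ≟ {suc n} g zero = begin
    g zero * 1 + sum (λ j → g (suc j) * 0) ≡⟨ cong₂ _+_ (ℕₚ.*-identityʳ (g zero)) (zeros n (g ∘ suc)) ⟩
    g zero + 0                             ≡⟨ ℕₚ.+-identityʳ _ ⟩
    g zero                                 ∎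
    where
    open ≡-Reasoning
    zeros : ∀ n (g : Fin n → ℕ) → sum (λ j → g j * 0) ≡ 0
    zeros zero    g = refl
    zeros (suc n) g = cong₂ _+_ (ℕₚ.*-zeroʳ (g zero)) (zeros n (g ∘ suc))
  sum-*χ≟ {suc n} g (suc i) = cong₂ _+_ (ℕₚ.*-zeroʳ (g zero)) (sum-*χ≟ (g ∘ suc) i)

  ∣∣≡sum : {P : Pred (Fin n) 0ℓ} (P? : Decidable P) (A : Subset n) →
           (∀ {i} → i ∈ A → P i) → (∀ {i} → P i → i ∈ A) → ∣ A ∣ ≡ sum (λ i → χ (P? i))
  ∣∣≡sum P? []            A⇒P P⇒A = refl
  ∣∣≡sum P? (inside ∷ A)  A⇒P P⇒A with P? zero
  ... | yes _ = cong suc (∣∣≡sum (P? ∘ suc) A (A⇒P ∘ there) (λ p → drop-there (P⇒A p)))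
  ... | no ¬p = contradiction (A⇒P here) ¬p
  ∣∣≡sum P? (outside ∷ A) A⇒P P⇒A with P? zero
  ... | yes p = contradiction (P⇒A p) (λ ())
  ... | no _  = ∣∣≡sum (P? ∘ suc) A (A⇒P ∘ there) (λ p → drop-there (P⇒A p))

  sumOn : Subset n → (Fin n → ℕ) → ℕ
  sumOn S g = sum (λ v → χ (v ∈? S) * g v)

  sumOn-+ : (S : Subset n) (f g : Fin n → ℕ) → sumOn S (λ v → f v + g v) ≡ sumOn S f + sumOn S g
  sumOn-+ S f g = trans (sum-cong-≗ (λ v → ℕₚ.*-distribˡ-+ (χ (v ∈? S)) (f v) (g v)))
                        (∑-distrib-+ (λ v → χ (v ∈? S) * f v) (λ v → χ (v ∈? S) * g v))

  sumOn-mono-< : (S : Subset n) {f g : Fin n → ℕ} → (∀ v → v ∈ S → f v ≤ g v) →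
                 ∀ v → v ∈ S → f v < g v → sumOn S f < sumOn S g
  sumOn-mono-< S {f} {g} f≤g v v∈S f<g = sum-mono-< weak v strict
    where
    weak : ∀ v → χ (v ∈? S) * f v ≤ χ (v ∈? S) * g v
    weak v with v ∈? S
    ... | yes v∈S = ℕₚ.+-monoˡ-≤ 0 (f≤g v v∈S)
    ... | no _    = z≤n
    strict : χ (v ∈? S) * f v < χ (v ∈? S) * g v
    strict with v ∈? S
    ... | yes _  = ℕₚ.+-monoˡ-< 0 f<g
    ... | no v∉S = contradiction v∈S v∉S

  join-injective : ∀ {m n} {i j : Fin m ⊎ Fin n} → join m n i ≡ join m n j → i ≡ j
  join-injective {m} {n} {i} {j} eq =
    trans (sym (splitAt-join m n i)) (trans (cong (Fin.splitAt m) eq) (splitAt-join m n j))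

  -- T? and F? stand for membership of an edge in T and in F ⊆ T, S₁? and S₂? for membership of its ends in S.
  module _ (T? : Dec P) (F? : Dec P₁) (F⇒T : P₁ → P) (S₁? : Dec P₂) (S₂? : Dec P₃) where

    χ-kept : χ T? ≡ χ (T? ×-dec (F? ⊎-dec (¬? S₁? ×-dec ¬? S₂?))) + χ ((T? ×-dec ¬? F?) ×-dec (S₁? ⊎-dec S₂?))
    χ-kept = go T? F? F⇒T S₁? S₂?
      where
      go : (T? : Dec P) (F? : Dec P₁) (F⇒T : P₁ → P) (S₁? : Dec P₂) (S₂? : Dec P₃) →
           χ T? ≡ χ (T? ×-dec (F? ⊎-dec (¬? S₁? ×-dec ¬? S₂?))) + χ ((T? ×-dec ¬? F?) ×-dec (S₁? ⊎-dec S₂?))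
      go (yes _) (yes _) _ _       _       = refl
      go (yes _) (no _)  _ (yes _) _       = refl
      go (yes _) (no _)  _ (no _)  (yes _) = refl
      go (yes _) (no _)  _ (no _)  (no _)  = refl
      go (no _)  _       _ _       _       = refl

    -- For an edge outside `F`, the number of ends in S is [some end in S] + [both ends in S]. An
    -- edge of `F` inside S also occurs in the last term on the right, and the extra term on the
    -- left balances it.
    χ-handshake : χ T? * (χ S₁? + χ S₂?) + χ (F? ×-dec (S₁? ×-dec S₂?)) ≡
                  χ F? * (χ S₁? + χ S₂?) + (χ ((T? ×-dec ¬? F?) ×-dec (S₁? ⊎-dec S₂?)) + χ (T? ×-dec (S₁? ×-dec S₂?)))
    χ-handshake = go T? F? F⇒T S₁? S₂?
      where
      go : (T? : Dec P) (F? : Dec P₁) (F⇒T : P₁ → P) (S₁? : Dec P₂) (S₂? : Dec P₃) →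
           χ T? * (χ S₁? + χ S₂?) + χ (F? ×-dec (S₁? ×-dec S₂?)) ≡
           χ F? * (χ S₁? + χ S₂?) + (χ ((T? ×-dec ¬? F?) ×-dec (S₁? ⊎-dec S₂?)) + χ (T? ×-dec (S₁? ×-dec S₂?)))
      go (no ¬t) (yes f) F⇒T _       _       = contradiction (F⇒T f) ¬t
      go (no _)  (no _)  _   _       _       = refl
      go (yes _) (yes _) _   (yes _) (yes _) = refl
      go (yes _) (yes _) _   (yes _) (no _)  = refl
      go (yes _) (yes _) _   (no _)  (yes _) = refl
      go (yes _) (yes _) _   (no _)  (no _)  = refl
      go (yes _) (no _)  _   (yes _) (yes _) = refl
      go (yes _) (no _)  _   (yes _) (no _)  = refl
      go (yes _) (no _)  _   (no _)  (yes _) = refl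
      go (yes _) (no _)  _   (no _)  (no _)  = refl

  -- Degree sums and descent on the excess

  module Counting (G : Graph) where
    open Graph G renaming (n to order; m to size)
    open GraphLemmas G

    deg≡sum : ∀ A v → deg G A v ≡ sum (λ e → χ (e ∈? A) * (χ (end₁ e ≟ v) + χ (end₂ e ≟ v)))
    deg≡sum A v = trans (∣∣≡sum both? (A ∩ incident G v) (λ p → map₂ ∈-incident⁻ (x∈p∩q⁻ A _ p))
                                      (λ (p , q) → x∈p∩q⁺ (p , ∈-incident⁺ q)))
                        (sum-cong-≗ λ e → pointwise (e ∈? A) (end₁ e ≟ v) (end₂ e ≟ v) (loopless e))
      where
      both? : ∀ e → Dec (e ∈ A × Incident e v)
      both? e = (e ∈? A) ×-dec ((end₁ e ≟ v) ⊎-dec (end₂ e ≟ v))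
      pointwise : ∀ {x y : Fin order} (P? : Dec P) (x? : Dec (x ≡ v)) (y? : Dec (y ≡ v)) → x ≢ y →
                  χ (P? ×-dec (x? ⊎-dec y?)) ≡ χ P? * (χ x? + χ y?)
      -- Looplessness: an edge counts at most once at `v`.
      pointwise _       (yes x≡v) (yes y≡v) x≢y = contradiction (trans x≡v (sym y≡v)) x≢y
      pointwise (no _)  _         _         _   = refl
      pointwise (yes _) (yes _)   (no _)    _   = refl
      pointwise (yes _) (no _)    (yes _)   _   = refl
      pointwise (yes _) (no _)    (no _)    _   = refl

    -- Double counting of incidences: after exchanging the sums, each inner sum picks out one end of
    -- `e`.
    sumOn-deg : ∀ S A → sumOn S (deg G A) ≡ sum (λ e → χ (e ∈? A) * (χ (end₁ e ∈? S) + χ (end₂ e ∈? S)))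
    sumOn-deg S A = begin
      sum (λ v → χS v * deg G A v)
        ≡⟨ sum-cong-≗ (λ v → cong (χS v *_) (deg≡sum A v)) ⟩
      sum (λ v → χS v * sum (λ e → χA e * (χ (end₁ e ≟ v) + χ (end₂ e ≟ v))))
        ≡⟨ sum-cong-≗ (λ v → *-distribˡ-sum (χS v) (λ e → χA e * (χ (end₁ e ≟ v) + χ (end₂ e ≟ v)))) ⟩
      sum (λ v → sum (λ e → χS v * (χA e * (χ (end₁ e ≟ v) + χ (end₂ e ≟ v)))))
        ≡⟨ ∑-comm (λ v e → χS v * (χA e * (χ (end₁ e ≟ v) + χ (end₂ e ≟ v)))) ⟩
      sum (λ e → sum (λ v → χS v * (χA e * (χ (end₁ e ≟ v) + χ (end₂ e ≟ v)))))
        ≡⟨ sum-cong-≗ edge ⟩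
      sum (λ e → χA e * (χS (end₁ e) + χS (end₂ e))) ∎
      where
      open ≡-Reasoning
      χS = λ v → χ (v ∈? S)
      χA = λ e → χ (e ∈? A)
      rearrange : ∀ s a p q → s * (a * (p + q)) ≡ a * (s * p + s * q)
      rearrange = solve 4 (λ s a p q → s :* (a :* (p :+ q)) := a :* (s :* p :+ s :* q)) refl
        where open +-*-Solver
      edge : ∀ e → sum (λ v → χS v * (χA e * (χ (end₁ e ≟ v) + χ (end₂ e ≟ v)))) ≡ χA e * (χS (end₁ e) + χS (end₂ e))
      edge e = begin
        sum (λ v → χS v * (χA e * (χ (end₁ e ≟ v) + χ (end₂ e ≟ v))))
          ≡⟨ sum-cong-≗ (λ v → rearrange (χS v) (χA e) (χ (end₁ e ≟ v)) (χ (end₂ e ≟ v))) ⟩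
        sum (λ v → χA e * (χS v * χ (end₁ e ≟ v) + χS v * χ (end₂ e ≟ v)))
          ≡⟨ *-distribˡ-sum (χA e) (λ v → χS v * χ (end₁ e ≟ v) + χS v * χ (end₂ e ≟ v)) ⟨
        χA e * sum (λ v → χS v * χ (end₁ e ≟ v) + χS v * χ (end₂ e ≟ v))
          ≡⟨ cong (χA e *_) (∑-distrib-+ (λ v → χS v * χ (end₁ e ≟ v)) (λ v → χS v * χ (end₂ e ≟ v))) ⟩
        χA e * (sum (λ v → χS v * χ (end₁ e ≟ v)) + sum (λ v → χS v * χ (end₂ e ≟ v)))
          ≡⟨ cong (χA e *_) (cong₂ _+_ (sum-*χ≟ χS (end₁ e)) (sum-*χ≟ χS (end₂ e))) ⟩
        χA e * (χS (end₁ e) + χS (end₂ e)) ∎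

    spanned? : ∀ A S e → Dec (e ∈ A × (end₁ e ∈ S × end₂ e ∈ S))
    spanned? A S e = (e ∈? A) ×-dec ((end₁ e ∈? S) ×-dec (end₂ e ∈? S))

    spanned : Subset size → Subset order → Subset size
    spanned A S = ⟪ spanned? A S ⟫

    ∣spanned∣ : ∀ A S → ∣ spanned A S ∣ ≡ sum (λ e → χ (spanned? A S e))
    ∣spanned∣ A S = ∣∣≡sum (spanned? A S) (spanned A S) (∈-⟪⟫⁻ (spanned? A S)) (∈-⟪⟫⁺ (spanned? A S))

    ∣spanned∣≤eG : ∀ A S → ∣ spanned A S ∣ ≤ eG G S
    ∣spanned∣≤eG A S = p⊆q⇒∣p∣≤∣q∣ λ {e} p → let _ , q , r = ∈-⟪⟫⁻ (spanned? A S) p in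
      ∈-tabulate⁺ e (from T-∧ (fromWitness {a? = end₁ e ∈? S} q , fromWitness {a? = end₂ e ∈? S} r))

    module _ (F : Subset size) (X : Subset order) (b : Fin order → ℕ) where

      excess : Subset size → ℕ
      excess T = sumOn X (λ v → deg G T v ∸ b v)

      BoundedTree : Set
      BoundedTree = Σ (Subset size) λ T → IsSpanningTree G T × F ⊆ T × (∀ v → v ∈ X → deg G T v ≤ b v)

      ObstructedTree : Set
      ObstructedTree = Σ (Subset size) λ T → Σ (F ⊆ T) λ F⊆T → Σ (ConnectedE G T) λ conn → Σ (Acyclic G T) λ acyc →
        Exchange.Obstruction G F X b T F⊆T conn acyc × ∃ λ v → v ∈ X × b v < deg G T v

      bounded-or-obstructed : IsConnected G → Acyclic G F → BoundedTree ⊎ ObstructedTree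
      bounded-or-obstructed G-conn F-acyc =
        let T , _ , F⊆T , conn , acyc = spanningTree G-conn (λ _ → ∈-allE) F-acyc in
        search T F⊆T conn acyc (<-wellFounded (excess T))
        where
        search : ∀ T → F ⊆ T → ConnectedE G T → Acyclic G T → Acc _<_ (excess T) → BoundedTree ⊎ ObstructedTree
        search T F⊆T conn acyc (acc rs) with any? (λ v → (v ∈? X) ×-dec (b v ℕₚ.<? deg G T v))
        ... | no none = inj₁ (T , (conn , acyc) , F⊆T , λ v v∈X → ℕₚ.≮⇒≥ (λ over → none (v , v∈X , over)))
        ... | yes over with Exchange.improve-or-obstruct G F X b T F⊆T conn acyc
        ... | inj₂ obstruction = inj₂ (T , F⊆T , conn , acyc , obstruction , over)
        ... | inj₁ (H , F⊆H , H-conn , bounded , v , v∈X , b<degT , degH<degT)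
            with spanningTree H-conn F⊆H F-acyc
        ... | T′ , T′⊆H , F⊆T′ , conn′ , acyc′ = search T′ F⊆T′ conn′ acyc′ (rs decrease)
          where
          decrease : excess T′ < excess T
          decrease = sumOn-mono-< X
            -- Truncation absorbs the maximum, `(b ⊔ d) ∸ b` being `d ∸ b`; so no vertex gains
            -- excess.
            (λ w w∈X → subst (deg G T′ w ∸ b w ≤_) (⊔-∸ (b w) (deg G T w))
              (ℕₚ.∸-monoˡ-≤ (b w) (ℕₚ.≤-trans (deg-⊆ T′⊆H w) (bounded w w∈X))))
            v v∈X (∸-mono-<ˡ (ℕₚ.≤-<-trans (deg-⊆ T′⊆H v) degH<degT) b<degT)
            where
            ⊔-∸ : ∀ m n → (m ⊔ n) ∸ m ≡ n ∸ m
            ⊔-∸ m n = trans (ℕₚ.∸-distribʳ-⊔ m m n) (cong (_⊔ (n ∸ m)) (ℕₚ.n∸n≡0 m))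
            ∸-mono-<ˡ : ∀ {m n o} → m < n → o < n → m ∸ o < n ∸ o
            ∸-mono-<ˡ {o = zero}              m<n       _         = m<n
            ∸-mono-<ˡ {m = zero}  {o = suc o} _         (s≤s o<n) = ℕₚ.m<n⇒0<n∸m o<n
            ∸-mono-<ˡ {m = suc m} {o = suc o} (s≤s m<n) (s≤s o<n) = ∸-mono-<ˡ m<n o<n

  -- Counting components at an obstruction

  module Violation (G : Graph) (F : Subset (Graph.m G)) (X : Subset (Graph.n G)) (h : Fin (Graph.n G) → ℕ) where
    open Graph G renaming (n to order; m to size)
    open GraphLemmas G
    open Counting G

    b : Fin order → ℕ
    b v = h v + (deg G F v ∸ 1)

    -- `t` stands for e_T(S); of the tree only its two upper bounds are passed on.
    Violated : Set
    Violated = Σ (Subset order) λ S → S ⊆ X × ∃ λ k → ComponentCount G (∁ S) k ×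
               ∃ λ t → t < ∣ S ∣ × t ≤ eG G S × sumOn S h + 2 ≤ k + t + ∣ S ∣

    obstructed⇒violated : ObstructedTree F X b → Violated
    obstructed⇒violated (T , F⊆T , conn , acyc , obstruction , (s , s∈X , over)) =
      S , S⊆X , k , (c , components-S) , ∣ spanned T S ∣ ,
      acyclic⇒∣∣< (acyclic-⊆ (proj₁ ∘ ∈-⟪⟫⁻ (spanned? T S)) acyc) (proj₂ ∘ ∈-⟪⟫⁻ (spanned? T S)) s∈S ,
      ∣spanned∣≤eG T S , conclusion
      where
      open Exchange G F X b T F⊆T conn acyc
      open Obstruction obstruction

      s∈S : s ∈ S
      s∈S = overfull s s∈X over

      k = proj₁ (components (∁ S))
      c = proj₁ (proj₂ (components (∁ S)))
      components-S = proj₂ (proj₂ (components (∁ S)))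

      isolated? : ∀ v → Dec (v ∈ S × deg G F v ≡ 0)
      isolated? v = (v ∈? S) ×-dec (deg G F v ℕₚ.≟ 0)

      I = ⟪ isolated? ⟫
      E = spanned F S

      removed? : ∀ e → Dec ((e ∈ T × e ∉ F) × (end₁ e ∈ S ⊎ end₂ e ∈ S))
      removed? e = ((e ∈? T) ×-dec ¬? (e ∈? F)) ×-dec ((end₁ e ∈? S) ⊎-dec (end₂ e ∈? S))

      removed = sum (λ e → χ (removed? e))

      -- Vertices sharing a label are connected in kept S, which bounds the number of its components by that of labels.
      Labelled : Fin order → Fin k ⊎ (Fin ∣ I ∣ ⊎ Fin ∣ E ∣) → Set
      Labelled v (inj₁ i)        = ∃ λ w → Σ (w ∈ ∁ S) λ p → c w p ≡ i × kept S ⊢ v ∼ w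
      Labelled v (inj₂ (inj₁ i)) = Σ (v ∈ I) λ p → index I v p ≡ i
      Labelled v (inj₂ (inj₂ i)) = ∃ λ e → Σ (e ∈ E) λ p → index E e p ≡ i × kept S ⊢ v ∼ end₁ e

      F-edge : ∀ {e} → e ∈ F → kept S ⊢ end₁ e ∼ end₂ e
      F-edge e∈F = ∼-edge (∈-kept⁺ (F⊆T e∈F , inj₁ e∈F))

      -- A vertex of `S` isolated in `F` labels itself. Any other vertex of `S` has an edge of `F`,
      -- which is kept: it leads to a component outside `S`, whose label is taken, or stays inside
      -- `S` and is itself the label.
      label : ∀ v → ∃ (Labelled v)
      label v with v ∈? S | deg G F v in d≡
      ... | no v∉S  | _      = inj₁ _ , v , x∉p⇒x∈∁p v∉S , refl , ∼-refl
      ... | yes v∈S | zero   = inj₂ (inj₁ _) , ∈-⟪⟫⁺ isolated? (v∈S , d≡) , refl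
      ... | yes v∈S | suc d  with ∣∣>0⇒nonempty (F ∩ incident G v) (subst (0 <_) (sym d≡) (s≤s z≤n))
      ... | e , p with x∈p∩q⁻ F _ p
      ... | e∈F , q with ∈-incident⁻ q
      ... | inj₁ refl with end₂ e ∈? S
      ...   | yes w∈S = inj₂ (inj₂ _) , e , ∈-⟪⟫⁺ (spanned? F S) (e∈F , v∈S , w∈S) , refl , ∼-refl
      ...   | no w∉S  = inj₁ _ , end₂ e , x∉p⇒x∈∁p w∉S , refl , F-edge e∈F
      label v | yes v∈S | suc d | e , p | e∈F , q | inj₂ refl with end₁ e ∈? S
      ...   | yes w∈S = inj₂ (inj₂ _) , e , ∈-⟪⟫⁺ (spanned? F S) (e∈F , w∈S , v∈S) , refl , reach-sym (F-edge e∈F)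
      ...   | no w∉S  = inj₁ _ , end₁ e , x∉p⇒x∈∁p w∉S , refl , reach-sym (F-edge e∈F)

      -- For component labels, `closed` replaces each edge of G that avoids `S` by a connection in
      -- `kept S`.
      Labelled-connects : ∀ {u v} i → Labelled u i → Labelled v i → kept S ⊢ u ∼ v
      Labelled-connects (inj₁ i) (w , p , eq , u∼w) (w′ , p′ , eq′ , v∼w′) =
        reach-trans u∼w (reach-trans
          (reach-closed (λ e _ q r → closed e (x∈∁p⇒x∉p q , x∈∁p⇒x∉p r))
            (proj₁ (proj₂ components-S w w′ p p′) (trans eq (sym eq′))))
          (reach-sym v∼w′))
      Labelled-connects {u} (inj₂ (inj₁ i)) (p , eq) (p′ , eq′) =
        subst (kept S ⊢ u ∼_) (index-injective I p p′ (trans eq (sym eq′))) ∼-refl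
      Labelled-connects {u} (inj₂ (inj₂ i)) (e , p , eq , u∼e) (e′ , p′ , eq′ , v∼e′) =
        reach-trans (subst (λ f → kept S ⊢ u ∼ end₁ f) (index-injective E p p′ (trans eq (sym eq′))) u∼e)
                    (reach-sym v∼e′)

      order≤ : order ≤ (k + (∣ I ∣ + ∣ E ∣)) + ∣ kept S ∣
      order≤ = order≤labels+edges (encode ∘ proj₁ ∘ label) λ u v eq →
        Labelled-connects (proj₁ (label v))
          (subst (Labelled u) (encode-injective eq) (proj₂ (label u))) (proj₂ (label v))
        where
        encode : Fin k ⊎ (Fin ∣ I ∣ ⊎ Fin ∣ E ∣) → Fin (k + (∣ I ∣ + ∣ E ∣))
        encode = join k _ ∘ ⊎-map id (join ∣ I ∣ ∣ E ∣)
        encode-injective : ∀ {i j} → encode i ≡ encode j → i ≡ j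
        encode-injective {i} {j} eq = map₂-injective i j (join-injective eq)
          where
          map₂-injective : ∀ i j → ⊎-map id (join ∣ I ∣ ∣ E ∣) i ≡ ⊎-map id (join ∣ I ∣ ∣ E ∣) j → i ≡ j
          map₂-injective (inj₁ _) (inj₁ _) refl = refl
          map₂-injective (inj₂ i) (inj₂ j) eq   = cong inj₂ (join-injective (inj₂-injective eq))

      ∣T∣ : ∣ T ∣ ≡ ∣ kept S ∣ + removed
      ∣T∣ = begin
        ∣ T ∣                                           ≡⟨ ∣∣≡sum (_∈? T) T id id ⟩
        sum (λ e → χ (e ∈? T))                          ≡⟨ sum-cong-≗ (λ e → χ-kept (e ∈? T) (e ∈? F) F⊆T (end₁ e ∈? S) (end₂ e ∈? S)) ⟩
        sum (λ e → χ (kept? S e) + χ (removed? e))      ≡⟨ ∑-distrib-+ (λ e → χ (kept? S e)) (λ e → χ (removed? e)) ⟩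
        sum (λ e → χ (kept? S e)) + removed             ≡⟨ cong (_+ removed) (∣∣≡sum (kept? S) (kept S) ∈-kept⁻ ∈-kept⁺) ⟨
        ∣ kept S ∣ + removed                            ∎
        where open ≡-Reasoning

      ∣T∣<order : ∣ T ∣ < order
      ∣T∣<order = ℕₚ.<-≤-trans (acyclic⇒∣∣< acyc (λ _ → ∈-allV , ∈-allV) {s} ∈-allV) (∣p∣≤n (allV G))

      -- A tree has fewer edges than vertices, and `order≤` bounds the vertices by labels plus kept
      -- edges; the kept edges cancel.
      removed< : removed < k + (∣ I ∣ + ∣ E ∣)
      removed< = ℕₚ.+-cancelʳ-< ∣ kept S ∣ _ _ (begin-strict
        removed + ∣ kept S ∣                    ≡⟨ ℕₚ.+-comm removed _ ⟩
        ∣ kept S ∣ + removed                    ≡⟨ ∣T∣ ⟨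
        ∣ T ∣                                   <⟨ ∣T∣<order ⟩
        order                                   ≤⟨ order≤ ⟩
        (k + (∣ I ∣ + ∣ E ∣)) + ∣ kept S ∣      ∎)
        where open ℕₚ.≤-Reasoning

      handshake : sumOn S (deg G T) + ∣ E ∣ ≡ sumOn S (deg G F) + (removed + ∣ spanned T S ∣)
      handshake = begin
        sumOn S (deg G T) + ∣ E ∣
          ≡⟨ cong₂ _+_ (sumOn-deg S T) (∣spanned∣ F S) ⟩
        sum (λ e → χ (e ∈? T) * ends-in e) + sum (λ e → χ (spanned? F S e))
          ≡⟨ ∑-distrib-+ (λ e → χ (e ∈? T) * ends-in e) (λ e → χ (spanned? F S e)) ⟨
        sum (λ e → χ (e ∈? T) * ends-in e + χ (spanned? F S e))
          ≡⟨ sum-cong-≗ (λ e → χ-handshake (e ∈? T) (e ∈? F) F⊆T (end₁ e ∈? S) (end₂ e ∈? S)) ⟩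
        sum (λ e → χ (e ∈? F) * ends-in e + (χ (removed? e) + χ (spanned? T S e)))
          ≡⟨ ∑-distrib-+ (λ e → χ (e ∈? F) * ends-in e) (λ e → χ (removed? e) + χ (spanned? T S e)) ⟩
        sum (λ e → χ (e ∈? F) * ends-in e) + sum (λ e → χ (removed? e) + χ (spanned? T S e))
          ≡⟨ cong₂ _+_ (sym (sumOn-deg S F)) (∑-distrib-+ (λ e → χ (removed? e)) (λ e → χ (spanned? T S e))) ⟩
        sumOn S (deg G F) + (removed + sum (λ e → χ (spanned? T S e)))
          ≡⟨ cong (λ t → sumOn S (deg G F) + (removed + t)) (∣spanned∣ T S) ⟨
        sumOn S (deg G F) + (removed + ∣ spanned T S ∣) ∎
        where
        open ≡-Reasoning
        ends-in : Fin size → ℕ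
        ends-in e = χ (end₁ e ∈? S) + χ (end₂ e ∈? S)

      -- The truncation in `d ∸ 1` takes effect exactly where d = 0, and `I` collects these
      -- vertices.
      sum-∸1 : sumOn S (λ v → deg G F v ∸ 1) + ∣ S ∣ ≡ sumOn S (deg G F) + ∣ I ∣
      sum-∸1 = begin
        sumOn S (λ v → deg G F v ∸ 1) + ∣ S ∣
          ≡⟨ cong (sumOn S (λ v → deg G F v ∸ 1) +_) (∣∣≡sum (_∈? S) S id id) ⟩
        sumOn S (λ v → deg G F v ∸ 1) + sum (λ v → χ (v ∈? S))
          ≡⟨ ∑-distrib-+ (λ v → χ (v ∈? S) * (deg G F v ∸ 1)) (λ v → χ (v ∈? S)) ⟨
        sum (λ v → χ (v ∈? S) * (deg G F v ∸ 1) + χ (v ∈? S))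
          ≡⟨ sum-cong-≗ (λ v → pointwise (v ∈? S) (deg G F v)) ⟩
        sum (λ v → χ (v ∈? S) * deg G F v + χ (isolated? v))
          ≡⟨ ∑-distrib-+ (λ v → χ (v ∈? S) * deg G F v) (λ v → χ (isolated? v)) ⟩
        sumOn S (deg G F) + sum (λ v → χ (isolated? v))
          ≡⟨ cong (sumOn S (deg G F) +_) (∣∣≡sum isolated? I (∈-⟪⟫⁻ isolated?) (∈-⟪⟫⁺ isolated?)) ⟨
        sumOn S (deg G F) + ∣ I ∣ ∎
        where
        open ≡-Reasoning
        pointwise : (P? : Dec P) (d : ℕ) → χ P? * (d ∸ 1) + χ P? ≡ χ P? * d + χ (P? ×-dec (d ℕₚ.≟ 0))
        pointwise (no _)  d       = refl
        pointwise (yes _) zero    = refl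
        pointwise (yes _) (suc d) = trans (ℕₚ.+-comm (d + 0) 1) (sym (ℕₚ.+-identityʳ _))

      sum-b< : sumOn S h + sumOn S (λ v → deg G F v ∸ 1) < sumOn S (deg G T)
      sum-b< = subst (_< sumOn S (deg G T)) (sumOn-+ S h _) (sumOn-mono-< S tight s s∈S over)

      combine : ∀ {H P N D I TT E j t k} → P + N ≡ D + I → TT + E ≡ D + (j + t) →
                H + P < TT → j < k + (I + E) → H + 2 ≤ k + t + N
      combine {H} {P} {N} {D} {I} {TT} {E} {j} {t} {k} P+N TT+E H+P< j< =
        -- All auxiliary quantities are added to both sides, so that the four relations can be
        -- summed without subtraction.
        ℕₚ.+-cancelʳ-≤ (P + D + I + TT + E + j) _ _ (begin
          H + 2 + (P + D + I + TT + E + j)                  ≡⟨ lhs H P D I TT E j ⟩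
          suc (H + P) + (D + I) + (TT + E) + suc j          ≤⟨ ℕₚ.+-mono-≤ (ℕₚ.+-mono-≤ (ℕₚ.+-mono-≤ H+P< (ℕₚ.≤-reflexive (sym P+N))) (ℕₚ.≤-reflexive TT+E)) j< ⟩
          TT + (P + N) + (D + (j + t)) + (k + (I + E))      ≡⟨ rhs P N D I TT E j t k ⟩
          k + t + N + (P + D + I + TT + E + j)              ∎)
        where
        open ℕₚ.≤-Reasoning
        open +-*-Solver
        lhs : ∀ H P D I TT E j → H + 2 + (P + D + I + TT + E + j) ≡ suc (H + P) + (D + I) + (TT + E) + suc j
        lhs = solve 7 (λ H P D I TT E j → H :+ con 2 :+ (P :+ D :+ I :+ TT :+ E :+ j) :=
                                         con 1 :+ (H :+ P) :+ (D :+ I) :+ (TT :+ E) :+ (con 1 :+ j)) refl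
        rhs : ∀ P N D I TT E j t k → TT + (P + N) + (D + (j + t)) + (k + (I + E)) ≡ k + t + N + (P + D + I + TT + E + j)
        rhs = solve 9 (λ P N D I TT E j t k → TT :+ (P :+ N) :+ (D :+ (j :+ t)) :+ (k :+ (I :+ E)) :=
                                             k :+ t :+ N :+ (P :+ D :+ I :+ TT :+ E :+ j)) refl

      conclusion : sumOn S h + 2 ≤ k + ∣ spanned T S ∣ + ∣ S ∣
      conclusion = combine {I = ∣ I ∣} sum-∸1 handshake sum-b< removed<

  -- Ordered-field inequalities and the final contradiction

  module OrderedFieldLemmas {c ℓ₁ ℓ₂ : Level} (R : OrderedField c ℓ₁ ℓ₂) where
    open OrderedField R
      renaming (_+_ to infixl 6 _⊕_; _*_ to infixl 7 _⊛_; _≤_ to infix 4 _≼_; _<_ to infix 4 _≺_; -_ to ⊝_; _-_ to infixl 6 _⊖_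
               ; refl to ≈-refl; sym to ≈-sym; trans to ≈-trans)
    open IsTotalOrder isTotalOrder using (antisym; isPartialOrder)
      renaming (reflexive to ≼-reflexive; refl to ≼-refl; trans to ≼-trans)
    open SemiringSolver commutativeSemiring using (solve; _:=_; _:+_; _:*_; con; Polynomial)

    poset : Poset c ℓ₁ ℓ₂
    poset = record { isPartialOrder = isPartialOrder }

    open ≤-Reasoning poset

    two : ∀ {n} → Polynomial n
    two = con 1 :+ con 1

    +-mono : ∀ {x y u v} → x ≼ y → u ≼ v → x ⊕ u ≼ y ⊕ v
    +-mono {x} {y} {u} {v} x≼y u≼v = begin
      x ⊕ u  ≤⟨ +-mono-≤ u x≼y ⟩
      y ⊕ u  ≈⟨ +-comm y u ⟩
      u ⊕ y  ≤⟨ +-mono-≤ y u≼v ⟩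
      v ⊕ y  ≈⟨ +-comm v y ⟩
      y ⊕ v  ∎

    x+y-y : ∀ x y → (x ⊕ y) ⊕ ⊝ y ≈ x
    x+y-y x y = ≈-trans (+-assoc x y (⊝ y)) (≈-trans (+-congˡ (-‿inverseʳ y)) (+-identityʳ x))

    x-y+y : ∀ x y → (x ⊖ y) ⊕ y ≈ x
    x-y+y x y = ≈-trans (+-assoc x (⊝ y) y) (≈-trans (+-congˡ (-‿inverseˡ y)) (+-identityʳ x))

    +-cancelʳ : ∀ {x y} z → x ⊕ z ≼ y ⊕ z → x ≼ y
    +-cancelʳ {x} {y} z le = begin
      x                  ≈⟨ x+y-y x z ⟨
      (x ⊕ z) ⊕ ⊝ z      ≤⟨ +-mono-≤ (⊝ z) le ⟩
      (y ⊕ z) ⊕ ⊝ z      ≈⟨ x+y-y y z ⟩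
      y                  ∎

    +-cancelˡ : ∀ {x y} z → z ⊕ x ≼ z ⊕ y → x ≼ y
    +-cancelˡ {x} {y} z le = +-cancelʳ z (begin
      x ⊕ z  ≈⟨ +-comm x z ⟩
      z ⊕ x  ≤⟨ le ⟩
      z ⊕ y  ≈⟨ +-comm z y ⟩
      y ⊕ z  ∎)

    ≼-sub⇒+ : ∀ {x y z} → x ≼ y ⊖ z → x ⊕ z ≼ y
    ≼-sub⇒+ {x} {y} {z} le = ≼-trans (+-mono-≤ z le) (≼-reflexive (x-y+y y z))

    sub-≼⇒+ : ∀ {x y z} → x ⊖ y ≼ z → x ≼ z ⊕ y
    sub-≼⇒+ {x} {y} {z} le = ≼-trans (≼-reflexive (≈-sym (x-y+y x y))) (+-mono-≤ y le)

    fromℕ-+ : ∀ m n → fromℕ (m + n) ≈ fromℕ m ⊕ fromℕ n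
    fromℕ-+ zero    n = ≈-sym (+-identityˡ _)
    fromℕ-+ (suc m) n = ≈-trans (+-congˡ (fromℕ-+ m n)) (≈-sym (+-assoc 1# _ _))

    -- Users of these lemmas obtain `0# ≼ 1#` from 0 ≤ λ ≤ 1.
    module _ (0≼1 : 0# ≼ 1#) where

      fromℕ-nonneg : ∀ n → 0# ≼ fromℕ n
      fromℕ-nonneg zero    = ≼-refl
      fromℕ-nonneg (suc n) = ≼-trans (≼-reflexive (≈-sym (+-identityˡ 0#))) (+-mono 0≼1 (fromℕ-nonneg n))

      fromℕ-mono : ∀ {m n} → m ≤ n → fromℕ m ≼ fromℕ n
      fromℕ-mono {n = n} z≤n = fromℕ-nonneg n
      fromℕ-mono (s≤s m≤n)   = +-mono ≼-refl (fromℕ-mono m≤n)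

      -- A negative ceiling would force `y ≼ x`. This allows the degree bounds to be treated as
      -- natural numbers.
      ceiling-nonneg : ∀ {x y} → x ≺ y → ∀ k → IsCeiling (y ⊖ x) k → k ≡ ℤ.+ ℤ.∣ k ∣
      ceiling-nonneg _ (ℤ.+ _) _ = refl
      ceiling-nonneg {x} {y} (x≼y , x≉y) ℤ.-[1+ n ] (_ , y-x≼) = ⊥-elim (x≉y (antisym x≼y (begin
        y                                    ≈⟨ +-identityʳ y ⟨
        y ⊕ 0#                               ≤⟨ +-mono ≼-refl (fromℕ-nonneg (suc n)) ⟩
        y ⊕ fromℕ (suc n)                    ≤⟨ +-mono-≤ _ (sub-≼⇒+ y-x≼) ⟩
        (⊝ fromℕ (suc n) ⊕ x) ⊕ fromℕ (suc n) ≈⟨ +-congʳ (+-comm _ x) ⟩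
        (x ⊖ fromℕ (suc n)) ⊕ fromℕ (suc n)  ≈⟨ x-y+y x _ ⟩
        x                                    ∎)))

    -- Termwise addition; the multiple of 2 on the left undoes the subtractions, leaving identities
    -- for the semiring solver.
    sumOver-bound : ∀ {n} (S : Subset n) (η : Fin n → Carrier) (h : Fin n → ℕ) (lam : Carrier) →
                    (∀ v → v ∈ S → η v ≼ fromℕ (h v) ⊕ lam) →
                    sumOver S (λ v → η v ⊖ 2#) ⊕ 2# ⊛ fromℕ ∣ S ∣ ≼ fromℕ (sumOn S h) ⊕ lam ⊛ fromℕ ∣ S ∣
    sumOver-bound [] η h lam η≼ =
      ≼-reflexive (+-congˡ (≈-trans (zeroʳ 2#) (≈-sym (zeroʳ lam))))
    sumOver-bound (outside ∷ S) η h lam η≼ = sumOver-bound S (η ∘ suc) (h ∘ suc) lam (λ v → η≼ (suc v) ∘ there)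
    sumOver-bound (inside ∷ S) η h lam η≼ = begin
      ((η zero ⊖ 2#) ⊕ Σ′) ⊕ 2# ⊛ (1# ⊕ s)
        ≈⟨ solve 3 (λ a σ s → (a :+ σ) :+ two :* (con 1 :+ s) := (a :+ two) :+ (σ :+ two :* s)) ≈-refl (η zero ⊖ 2#) Σ′ s ⟩
      ((η zero ⊖ 2#) ⊕ 2#) ⊕ (Σ′ ⊕ 2# ⊛ s)
        ≤⟨ +-mono (≼-trans (≼-reflexive (x-y+y (η zero) 2#)) (η≼ zero here))
                  (sumOver-bound S (η ∘ suc) (h ∘ suc) lam (λ v → η≼ (suc v) ∘ there)) ⟩
      (fromℕ (h zero) ⊕ lam) ⊕ (fromℕ (sumOn S (h ∘ suc)) ⊕ lam ⊛ s)
        ≈⟨ solve 4 (λ a l σ s → (a :+ l) :+ (σ :+ l :* s) := (a :+ σ) :+ l :* (con 1 :+ s)) ≈-refl (fromℕ (h zero)) lam _ s ⟩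
      (fromℕ (h zero) ⊕ fromℕ (sumOn S (h ∘ suc))) ⊕ lam ⊛ (1# ⊕ s)
        ≈⟨ +-congʳ (fromℕ-+ (h zero) _) ⟨
      fromℕ (h zero + sumOn S (h ∘ suc)) ⊕ lam ⊛ (1# ⊕ s)
        ≡⟨ cong (λ a → fromℕ (a + sumOn S (h ∘ suc)) ⊕ lam ⊛ (1# ⊕ s)) (ℕₚ.*-identityˡ (h zero)) ⟨
      fromℕ (sumOn (inside ∷ S) h) ⊕ lam ⊛ (1# ⊕ s) ∎
      where
      s = fromℕ ∣ S ∣
      Σ′ = sumOver S (λ v → η (suc v) ⊖ 2#)

    -- Write c = t + 1 + d and g = t + e. The three inequalities add up to λe + 1 + d ≤ λd, whereas
    -- λd ≤ d and 0 ≤ λe; this leaves 1 ≤ 0.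
    slack-contradiction : ∀ {lam} → 0# ≼ lam → lam ≼ 1# → ∀ {k t c g H σ} → t < c → t ≤ g → H + 2 ≤ k + t + c →
                          fromℕ k ≼ (σ ⊕ 2#) ⊖ lam ⊛ (fromℕ g ⊕ 1#) →
                          σ ⊕ 2# ⊛ fromℕ c ≼ fromℕ H ⊕ lam ⊛ fromℕ c → ⊥
    slack-contradiction {lam} 0≼lam lam≼1 {k} {t} {c} {g} {H} {σ} t<c t≤g H+2≤ k≼ σ≼
      with ℕₚ.m≤n⇒∃[o]m+o≡n t<c | ℕₚ.m≤n⇒∃[o]m+o≡n t≤g
    ... | d , refl | e , refl = 1≉0 (antisym 1≼0 0≼1)
      where
      0≼1 : 0# ≼ 1#
      0≼1 = ≼-trans 0≼lam lam≼1
      K = fromℕ k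
      T′ = fromℕ t
      D = fromℕ d
      E = fromℕ e
      -- The common part of both sides of the summed inequality, cancelled afterwards.
      Z = K ⊕ lam ⊛ (T′ ⊕ 1#) ⊕ 1# ⊕ T′ ⊕ T′ ⊕ D

      lam-D : lam ⊛ D ≼ D
      lam-D = begin
        lam ⊛ D                        ≈⟨ +-identityˡ _ ⟨
        0# ⊕ lam ⊛ D                   ≤⟨ +-mono-≤ _ (*-nonneg 0≼1-lam (fromℕ-nonneg 0≼1 d)) ⟩
        (1# ⊖ lam) ⊛ D ⊕ lam ⊛ D       ≈⟨ distribʳ D (1# ⊖ lam) lam ⟨
        ((1# ⊖ lam) ⊕ lam) ⊛ D         ≈⟨ *-congʳ (x-y+y 1# lam) ⟩
        1# ⊛ D                         ≈⟨ *-identityˡ D ⟩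
        D                              ∎
        where
        0≼1-lam : 0# ≼ 1# ⊖ lam
        0≼1-lam = ≼-trans (≼-reflexive (≈-sym (-‿inverseʳ lam))) (+-mono-≤ (⊝ lam) lam≼1)

      total : Z ⊕ (lam ⊛ E ⊕ 1# ⊕ D) ≼ Z ⊕ lam ⊛ D
      total = begin
        Z ⊕ (lam ⊛ E ⊕ 1# ⊕ D)
          ≈⟨ solve 5 (λ K l T D E → K :+ l :* (T :+ con 1) :+ con 1 :+ T :+ T :+ D :+ (l :* E :+ con 1 :+ D) :=
               (K :+ l :* ((T :+ E) :+ con 1)) :+ two :* (con 1 :+ (T :+ D))) ≈-refl K lam T′ D E ⟩
        (K ⊕ lam ⊛ ((T′ ⊕ E) ⊕ 1#)) ⊕ 2# ⊛ (1# ⊕ (T′ ⊕ D))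
          ≈⟨ +-cong (+-congˡ (*-congˡ (+-congʳ (fromℕ-+ t e)))) (*-congˡ (+-congˡ (fromℕ-+ t d))) ⟨
        (K ⊕ lam ⊛ (fromℕ (t + e) ⊕ 1#)) ⊕ 2# ⊛ fromℕ (suc t + d)
          ≤⟨ +-mono-≤ _ (≼-sub⇒+ k≼) ⟩
        (σ ⊕ 2#) ⊕ 2# ⊛ fromℕ (suc t + d)
          ≈⟨ solve 3 (λ σ w x → (σ :+ w) :+ x := (σ :+ x) :+ w) ≈-refl σ 2# _ ⟩
        (σ ⊕ 2# ⊛ fromℕ (suc t + d)) ⊕ 2#
          ≤⟨ +-mono-≤ 2# σ≼ ⟩
        (fromℕ H ⊕ lam ⊛ fromℕ (suc t + d)) ⊕ 2#
          ≈⟨ solve 2 (λ H x → (H :+ x) :+ two := (H :+ (con 1 :+ (con 1 :+ con 0))) :+ x) ≈-refl (fromℕ H) _ ⟩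
        (fromℕ H ⊕ fromℕ 2) ⊕ lam ⊛ fromℕ (suc t + d)
          ≈⟨ +-congʳ (fromℕ-+ H 2) ⟨
        fromℕ (H + 2) ⊕ lam ⊛ fromℕ (suc t + d)
          ≤⟨ +-mono-≤ _ (fromℕ-mono 0≼1 H+2≤) ⟩
        fromℕ (k + t + (suc t + d)) ⊕ lam ⊛ fromℕ (suc t + d)
          ≈⟨ +-cong (≈-trans (fromℕ-+ (k + t) (suc t + d)) (+-cong (fromℕ-+ k t) (+-congˡ (fromℕ-+ t d))))
                    (*-congˡ (+-congˡ (fromℕ-+ t d))) ⟩
        ((K ⊕ T′) ⊕ (1# ⊕ (T′ ⊕ D))) ⊕ lam ⊛ (1# ⊕ (T′ ⊕ D))
          ≈⟨ solve 4 (λ K l T D → ((K :+ T) :+ (con 1 :+ (T :+ D))) :+ l :* (con 1 :+ (T :+ D)) :=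
               K :+ l :* (T :+ con 1) :+ con 1 :+ T :+ T :+ D :+ l :* D) ≈-refl K lam T′ D ⟩
        Z ⊕ lam ⊛ D ∎

      1≼0 : 1# ≼ 0#
      1≼0 = begin
        1#              ≈⟨ +-identityˡ 1# ⟨
        0# ⊕ 1#         ≤⟨ +-mono-≤ 1# (*-nonneg 0≼lam (fromℕ-nonneg 0≼1 e)) ⟩
        lam ⊛ E ⊕ 1#    ≤⟨ +-cancelʳ D (≼-trans (+-cancelˡ Z total) (≼-trans lam-D (≼-reflexive (≈-sym (+-identityˡ D))))) ⟩
        0#              ∎

open import Data.Nat using (ℕ; _∸_)
open import Data.Integer as ℤ using (ℤ; +_)
open import Data.Fin using (Fin)
open import Data.Fin.Subset using (Subset; _∈_; _⊆_; ∁)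
open import Data.Product using (Σ; _×_; _,_; proj₂)
open import Data.Sum using ([_,_]′)
open import Data.Empty using (⊥-elim)
open import Function using (id)
open import Relation.Binary using (IsTotalOrder)
open import Relation.Binary.PropositionalEquality using (_≡_; sym; subst)
open BoundedDegreeTrees

theorem1p6 : ∀ {c ℓ₁ ℓ₂ : Level} (R : OrderedField c ℓ₁ ℓ₂) →
    let open OrderedField R in
    (ceil : Carrier → ℤ) → (∀ x → IsCeiling x (ceil x)) →
    (G : Graph) → IsConnected G →
    (X : Subset (Graph.n G)) →
    (F : Subset (Graph.m G)) → IsSpanningForest G F →
    (lam : Carrier) → 0# ≤ lam → lam ≤ 1# →
    (η : Fin (Graph.n G) → Carrier) → (∀ v → v ∈ X → lam < η v) →
    (∀ (S : Subset (Graph.n G)) → S ⊆ X → ∀ (k : ℕ) → ComponentCount G (∁ S) k →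
    fromℕ k ≤ ((sumOver S (λ v → η v - 2#) + 2#) - (lam * (fromℕ (eG G S) + 1#)))) →
    Σ (Subset (Graph.m G)) λ T →
    IsSpanningTree G T × (F ⊆ T) ×
    (∀ v → v ∈ X → (+ deg G T v) ℤ.≤ (ceil (η v - lam) ℤ.+ (+ (deg G F v ∸ 1))))
theorem1p6 R ceil isCeil G G-conn X F F-acyc lam 0≤lam lam≤1 η lam<η condition =
  let T , tree , F⊆T , deg≤b = boundedTree in
  T , tree , F⊆T , λ v v∈X →
    subst (λ k → + deg G T v ℤ.≤ k ℤ.+ (+ (deg G F v ∸ 1))) (sym (ceil≡ v v∈X)) (ℤ.+≤+ (deg≤b v v∈X))
  where
  open OrderedField R using (_≤_; _-_; fromℤ)
  open OrderedFieldLemmas R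
  h : Fin (Graph.n G) → ℕ
  h v = ℤ.∣ ceil (η v - lam) ∣
  open Violation G F X h
  open Counting G
  ceil≡ : ∀ v → v ∈ X → ceil (η v - lam) ≡ + h v
  ceil≡ v v∈X = ceiling-nonneg (IsTotalOrder.trans (OrderedField.isTotalOrder R) 0≤lam lam≤1) (lam<η v v∈X) _ (isCeil _)
  boundedTree : BoundedTree F X b
  boundedTree = [ id , (λ obstructed →
    let S , S⊆X , k , count , _ , t< , t≤ , h≤ = obstructed⇒violated obstructed in
    ⊥-elim (slack-contradiction 0≤lam lam≤1 t< t≤ h≤ (condition S S⊆X k count)
      (sumOver-bound S η h lam λ v v∈S → sub-≼⇒+ (subst (λ k → (η v - lam) ≤ fromℤ k) (ceil≡ v (S⊆X v∈S))
        (proj₂ (isCeil (η v - lam))))))) ]′ (bounded-or-obstructed F X b G-conn F-acyc)
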